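{- Let $k$ be a positive integer and let $G$ be a bridgeless cyclically $k$-edge-connected cubic graph. If $k \geq 5\mu_2(G) - 3$, then $G$ has a nowhere-zero 5-flow.
   Context: A cubic graph is a graph all of whose vertices have degree 3 (graphs are finite). A graph is cyclically $k$-edge-connected if it has no edge cut $E$ with fewer than $k$ edges such that two components of $G-E$ contain circuits. A 1-factor of $G$ is a perfect matching, regarded as a set of edges. For a bridgeless cubic graph $G$, $\mu_2(G) = \min\{|M_1 \cap M_2| : M_1 \text{ and } M_2 \text{ are 1-factors of } G\}$ (1-factors exist by Petersen's theorem). A nowhere-zero $k$-flow on $G$ is an assignment of a direction and a value from $\{1,\dots,k-1\}$ to each edge of $G$ such that Kirchhoff's law holds at every vertex (the sum of the values on incoming edges equals the sum of the values on outgoing edges). -}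

module Defs where

open import Data.Bool.Base using (if_then_else_; _xor_)
open import Data.Fin.Base using (Fin)
open import Data.Fin.Properties using (_≟_)
open import Data.Fin.Subset using (Subset; _∈_; _⊆_; _∩_; ∁; ⁅_⁆; ⊤; ∣_∣; Nonempty)
open import Data.Nat.Base using (ℕ; _+_; _≤_; _<_)
open import Data.Nat.Properties using (+-0-commutativeMonoid)
open import Data.Product.Base using (_×_; ∃-syntax)
open import Data.Sum.Base using (_⊎_)
open import Data.Vec.Base using (lookup; tabulate)
open import Relation.Binary.Construct.Closure.ReflexiveTransitive using (Star)
open import Relation.Binary.PropositionalEquality.Core using (_≡_; _≢_)
open import Relation.Nullary.Decidable.Core using (does)
open import Relation.Nullary.Negation.Core using (¬_)

open import Algebra.Properties.CommutativeMonoid.Sum +-0-commutativeMonoid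
  using (sum)

-- A finite undirected graph; parallel edges and loops are allowed.
-- The ends of an edge are stored as end₁ and end₂, but which end comes
-- first carries no meaning.
record Graph : Set where
  field
    #V #E : ℕ
    end₁ end₂ : Fin #E → Fin #V

data Direction : Set where
  1→2 2→1 : Direction

[_≐_] : ∀ {n} → Fin n → Fin n → ℕ
[ u ≐ v ] = if does (u ≟ v) then 1 else 0

module _ (G : Graph) where
  open Graph G

  VertexSet EdgeSet : Set
  VertexSet = Subset #V
  EdgeSet   = Subset #E

  -- The degree of v in the spanning subgraph with edge set S; a loop
  -- counts twice.
  degree : EdgeSet → Fin #V → ℕ
  degree S v =
    sum λ e → if lookup S e then [ end₁ e ≐ v ] + [ end₂ e ≐ v ] else 0

  Cubic : Set
  Cubic = ∀ v → degree ⊤ v ≡ 3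

  Joins : Fin #E → Fin #V → Fin #V → Set
  Joins e u v = (end₁ e ≡ u × end₂ e ≡ v) ⊎ (end₁ e ≡ v × end₂ e ≡ u)

  -- There is a walk from u to v using only edges of S.  The subgraph
  -- G - E is the case S = ∁ E.
  Connected : EdgeSet → Fin #V → Fin #V → Set
  Connected S = Star λ u v → ∃[ e ] e ∈ S × Joins e u v

  IsBridge : Fin #E → Set
  IsBridge e = ¬ Connected (∁ ⁅ e ⁆) (end₁ e) (end₂ e)

  Bridgeless : Set
  Bridgeless = ∀ e → ¬ IsBridge e

  -- The set of edges with exactly one end in X.
  ∂ : VertexSet → EdgeSet
  ∂ X = tabulate λ e → lookup X (end₁ e) xor lookup X (end₂ e)

  IsEdgeCut : EdgeSet → Set
  IsEdgeCut E = ∃[ X ] Nonempty X × Nonempty (∁ X) × E ≡ ∂ X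

  -- X is the vertex set of a component of (V , S).
  IsComponent : EdgeSet → VertexSet → Set
  IsComponent S X =
    Nonempty X ×
    (∀ {u v} → u ∈ X → v ∈ X → Connected S u v) ×
    (∀ {u v} → u ∈ X → Connected S u v → v ∈ X)

  -- A circuit is a nonempty connected 2-regular subgraph, given by its
  -- edge set F; its vertices are those of degree 2 in F.  Loops and pairs
  -- of parallel edges are circuits.
  IsCircuit : EdgeSet → Set
  IsCircuit F =
    Nonempty F ×
    (∀ v → degree F v ≡ 0 ⊎ degree F v ≡ 2) ×
    (∀ {u v} → degree F u ≡ 2 → degree F v ≡ 2 → Connected F u v)

  -- The component X of (V , S) contains a circuit.
  ContainsCircuit : EdgeSet → VertexSet → Set
  ContainsCircuit S X =
    ∃[ F ] IsCircuit F × F ⊆ S × (∀ {e} → e ∈ F → end₁ e ∈ X × end₂ e ∈ X)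

  TwoComponentsWithCircuits : EdgeSet → Set
  TwoComponentsWithCircuits S =
    ∃[ X ] ∃[ Y ] X ≢ Y ×
      IsComponent S X × ContainsCircuit S X ×
      IsComponent S Y × ContainsCircuit S Y

  CyclicallyEdgeConnected : ℕ → Set
  CyclicallyEdgeConnected k =
    ¬ (∃[ E ] IsEdgeCut E × ∣ E ∣ < k × TwoComponentsWithCircuits (∁ E))

  Is1Factor : EdgeSet → Set
  Is1Factor M = ∀ v → degree M v ≡ 1

  IsIntersectionSize : ℕ → Set
  IsIntersectionSize m =
    ∃[ M₁ ] ∃[ M₂ ] Is1Factor M₁ × Is1Factor M₂ × m ≡ ∣ M₁ ∩ M₂ ∣

  -- m = μ₂(G).  The minimum is given as a relation because it is defined
  -- only for graphs that have a 1-factor; by Petersen's theorem every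
  -- bridgeless cubic graph does.
  Isμ₂ : ℕ → Set
  Isμ₂ m = IsIntersectionSize m × (∀ {j} → IsIntersectionSize j → m ≤ j)

  source target : Direction → Fin #E → Fin #V
  source 1→2 = end₁
  source 2→1 = end₂
  target 1→2 = end₂
  target 2→1 = end₁

  record NowhereZeroFlow (k : ℕ) : Set where
    field
      direction : Fin #E → Direction
      value     : Fin #E → ℕ
      value≥1   : ∀ e → 1 ≤ value e
      value<k   : ∀ e → value e < k
      kirchhoff : ∀ v →
        sum (λ e → if does (target (direction e) e ≟ v) then value e else 0) ≡
        sum (λ e → if does (source (direction e) e ≟ v) then value e else 0)

{-# OPTIONS --safe #-}

-- Let M₁ and M₂ be 1-factors with |M₁ ∩ M₂| = μ₂, and let F be the 2-factor
-- complementary to M₁.  By augmentation M₂ ∖ M₁ improves to a matching M ⊆ F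
-- such that every circuit of F has at most one vertex not covered by M; the set Z
-- of uncovered vertices has at most 2μ₂ elements.  The graph M₁ ∪ M is bipartite, so
-- its vertices can be coloured with both M₁ and M bichromatic, and then each
-- colour occurs on half of the vertices and on half of Z.
--
-- Let X contain p and m vertices of the two colours and let d = |∂X|.  Counting
-- along M₁ and along M gives m - p ≤ |∂X ∩ M₁| and m - p ≤ |∂X ∩ M| + z, where z
-- is the number of vertices of the second colour in Z ∩ X.  If every circuit of F
-- through a vertex of Z ∩ X leaves X, then 2z ≤ |∂X ∩ F|, hence 5(m - p) ≤ 3d.
-- The same holds if every circuit through Z ∖ X leaves the complement of X.
-- Otherwise ∂X separates two circuits, so d ≥ k ≥ 5μ₂ - 3, and 2(m - p) ≤ d + μ₂
-- together with 3(p + m) ≡ d (mod 2) again gives 5(m - p) ≤ 3d.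
--
-- Thus the values ±5/3 on the colour classes form a balanced valuation in the
-- sense of Bondy and Jaeger, which is the same as a nowhere-zero 5-flow.
module Submission where

open import Defs
open import Data.Bool.Base using (Bool; true; false; not; _∧_; _∨_; _xor_; if_then_else_)
import Data.Bool.Properties as Bool
open import Data.Fin.Base using (Fin; zero; suc)
import Data.Fin.Properties as Fin
open import Data.Fin.Properties using (_≟_; any?; suc-injective)
open import Data.Fin.Subset using (Subset; _∈_; ∁; ∣_∣; ⊤; _∩_)
open import Data.Fin.Subset.Properties using (_∈?_)
open import Data.Nat using (ℕ; _*_; _∸_; _≥_; _>_)
import Data.Nat as ℕ
open import Data.Nat using (zero; suc; _+_; _≤_; _<_; z≤n; s≤s; _<?_)
open import Data.Nat.Properties hiding (_≟_; suc-injective)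
open import Data.Nat.Tactic.RingSolver using (solve-∀)
open import Data.Product.Base using (∃-syntax; Σ-syntax; _×_; _,_; proj₁)
open import Data.Sum.Base using (_⊎_; inj₁; inj₂)
open import Data.Vec.Base using (lookup; tabulate; []; _∷_)
open import Data.Vec.Properties
  using (lookup⇒[]=; []=⇒lookup; lookup∘tabulate; lookup-map; lookup-zipWith; lookup-replicate)
open import Function.Base using (_∘_)
open import Relation.Binary.Construct.Closure.ReflexiveTransitive as Star
  using (Star; ε; _◅_; _◅◅_; reverse)
open import Relation.Binary.Definitions using (tri<; tri≈; tri>)
open import Relation.Binary.PropositionalEquality
open import Relation.Nullary.Decidable
  using (Dec; yes; no; does; dec-true; dec-false; decidable-stable; ¬?; _×-dec_; _⊎-dec_)
open import Relation.Nullary.Negation using (¬_; contradiction)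

open import Algebra.Properties.CommutativeMonoid.Sum +-0-commutativeMonoid
  using (sum; sum-cong-≗; ∑-distrib-+; ∑-comm; sum-replicate-zero)
open import Algebra.Properties.Semiring.Sum +-*-semiring using (*-distribˡ-sum)

-- The step from the balanced valuation to the flow rests on Hakimi's theorem, applied twice: with
-- one token per edge it gives an orientation with out-degrees 2 and 1 on the two colours, and with
-- three tokens per edge it gives the flow values. Hakimi's condition speaks of the number i of
-- edges inside X, not of the cut. As 2i + d = 3(p + m) in a cubic graph, 5(m - p) ≤ 3d is
-- equivalent to 3i ≤ 7p + 2m. This is the form in which the bound is used: it lives in ℕ, and the
-- parity of d is contained in i being an integer. Only the excess of one colour has to be bounded,
-- for every X: the colour classes have equal size, so the other sign is the same inequality for the
-- complement of X. The 3 in the hypothesis is the largest slack that parity absorbs: in the last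
-- case 10(m - p) ≤ 5d + 5μ₂ ≤ 6d + 3, while 10(m - p) - 6d is a multiple of 4.

ι : Bool → ℕ
ι b = if b then 1 else 0

does⇒ : ∀ {p} {P : Set p} (P? : Dec P) → does P? ≡ true → P
does⇒ (yes p) _ = p

true≢false : ∀ {b} → b ≡ true → b ≢ false
true≢false refl ()

-- Finite sums of natural numbers.

sum-mono : ∀ {n} {f g : Fin n → ℕ} → (∀ i → f i ≤ g i) → sum f ≤ sum g
sum-mono {zero}  f≤g = z≤n
sum-mono {suc n} f≤g = +-mono-≤ (f≤g zero) (sum-mono (f≤g ∘ suc))

sum-const : ∀ n c → sum {n} (λ _ → c) ≡ n * c
sum-const zero    c = refl
sum-const (suc n) c = cong (c +_) (sum-const n c)

term≤sum : ∀ {n} (f : Fin n → ℕ) i → f i ≤ sum f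
term≤sum f zero    = m≤m+n _ _
term≤sum f (suc i) = ≤-trans (term≤sum (f ∘ suc) i) (m≤n+m _ (f zero))

sum-positive : ∀ {n} (f : Fin n → ℕ) → 0 < sum f → ∃[ i ] 0 < f i
sum-positive {suc n} f 0<Σ with f zero in eq
... | suc _ = zero , subst (0 <_) (sym eq) (s≤s z≤n)
... | zero  = let i , p = sum-positive (f ∘ suc) 0<Σ in suc i , p

sum-pointwise-≡ : ∀ {n} {f g : Fin n → ℕ} → (∀ i → f i ≤ g i) → sum f ≡ sum g → ∀ i → f i ≡ g i
sum-pointwise-≡ {suc n} {f} {g} f≤g Σ≡ = λ where
    zero    → head≡
    (suc i) → sum-pointwise-≡ (f≤g ∘ suc) (+-cancelˡ-≡ (f zero) _ _ (trans Σ≡ (cong (_+ _) (sym head≡)))) i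
  where
  head≡ : f zero ≡ g zero
  head≡ = ≤-antisym (f≤g zero)
    (+-cancelʳ-≤ (sum (g ∘ suc)) _ _
      (≤-trans (≤-reflexive (sym Σ≡)) (+-monoʳ-≤ (f zero) (sum-mono (f≤g ∘ suc)))))

sum-ι-unique : ∀ {n} (b : Fin n → Bool) →
  (∀ {i j} → b i ≡ true → b j ≡ true → i ≡ j) → sum (ι ∘ b) ≤ 1
sum-ι-unique {zero}  b unique = z≤n
sum-ι-unique {suc n} b unique with b zero in eq
... | false = sum-ι-unique (b ∘ suc) λ p q → suc-injective (unique p q)
... | true  = s≤s (≤-reflexive (trans (sum-cong-≗ rest≡0) (sum-replicate-zero n)))
  where
  rest≡0 : ∀ i → ι (b (suc i)) ≡ 0
  rest≡0 i with b (suc i) in eq′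
  ... | false = refl
  ... | true  with () ← unique eq eq′

≐-refl : ∀ {n} (u : Fin n) → [ u ≐ u ] ≡ 1
≐-refl u = cong ι (dec-true (u ≟ u) refl)

≐-≢ : ∀ {n} {u v : Fin n} → u ≢ v → [ u ≐ v ] ≡ 0
≐-≢ {u = u} {v} u≢v = cong ι (dec-false (u ≟ v) u≢v)

sum-*≐ : ∀ {n} (x : Fin n → ℕ) u → sum (λ v → x v * [ u ≐ v ]) ≡ x u
sum-*≐ {suc n} x zero = begin
  x zero * 1 + sum (λ v → x (suc v) * 0)
    ≡⟨ cong₂ _+_ (*-identityʳ (x zero)) (sum-cong-≗ (λ v → *-zeroʳ (x (suc v)))) ⟩
  x zero + sum {n} (λ _ → 0)
    ≡⟨ cong (x zero +_) (sum-replicate-zero n) ⟩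
  x zero + 0
    ≡⟨ +-identityʳ (x zero) ⟩
  x zero ∎
  where open ≡-Reasoning
sum-*≐ {suc n} x (suc u) = cong₂ _+_ (*-zeroʳ (x zero)) (sum-*≐ (x ∘ suc) u)

sum-≐ : ∀ {n} (u : Fin n) → sum (λ v → [ u ≐ v ]) ≡ 1
sum-≐ u = trans (sum-cong-≗ λ v → sym (+-identityʳ [ u ≐ v ])) (sum-*≐ (λ _ → 1) u)

two-terms≤sum : ∀ {n} (f : Fin n → ℕ) {i j} → i ≢ j → 1 ≤ f i → 1 ≤ f j → 2 ≤ sum f
two-terms≤sum f {i} {j} i≢j 1≤fi 1≤fj = begin
  2                                      ≡⟨ cong₂ _+_ (sum-≐ i) (sum-≐ j) ⟨
  sum ([ i ≐_]) + sum ([ j ≐_])          ≡⟨ ∑-distrib-+ [ i ≐_] [ j ≐_] ⟨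
  sum (λ k → [ i ≐ k ] + [ j ≐ k ])      ≤⟨ sum-mono bound ⟩
  sum f ∎
  where
  open ≤-Reasoning
  bound : ∀ k → [ i ≐ k ] + [ j ≐ k ] ≤ f k
  bound k with i ≟ k | j ≟ k
  ... | yes refl | yes refl = contradiction refl i≢j
  ... | yes refl | no _     = 1≤fi
  ... | no _     | yes refl = 1≤fj
  ... | no _     | no _     = z≤n

three-terms≤sum : ∀ {n} (f : Fin n → ℕ) {i j k} → i ≢ j → i ≢ k → j ≢ k →
  1 ≤ f i → 1 ≤ f j → 1 ≤ f k → 3 ≤ sum f
three-terms≤sum f {i} {j} {k} i≢j i≢k j≢k 1≤fi 1≤fj 1≤fk = begin
  3
    ≡⟨ cong₂ _+_ (sum-≐ i) (cong₂ _+_ (sum-≐ j) (sum-≐ k)) ⟨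
  sum [ i ≐_] + (sum [ j ≐_] + sum [ k ≐_])
    ≡⟨ cong (sum [ i ≐_] +_) (∑-distrib-+ [ j ≐_] [ k ≐_]) ⟨
  sum [ i ≐_] + sum (λ l → [ j ≐ l ] + [ k ≐ l ])
    ≡⟨ ∑-distrib-+ [ i ≐_] (λ l → [ j ≐ l ] + [ k ≐ l ]) ⟨
  sum (λ l → [ i ≐ l ] + ([ j ≐ l ] + [ k ≐ l ]))
    ≤⟨ sum-mono bound ⟩
  sum f ∎
  where
  open ≤-Reasoning
  bound : ∀ l → [ i ≐ l ] + ([ j ≐ l ] + [ k ≐ l ]) ≤ f l
  bound l with i ≟ l | j ≟ l | k ≟ l
  ... | yes refl | yes refl | _        = contradiction refl i≢j
  ... | yes refl | no _     | yes refl = contradiction refl i≢k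
  ... | no _     | yes refl | yes refl = contradiction refl j≢k
  ... | yes refl | no _     | no _     = 1≤fi
  ... | no _     | yes refl | no _     = 1≤fj
  ... | no _     | no _     | yes refl = 1≤fk
  ... | no _     | no _     | no _     = z≤n

-- Reachability in finite graphs.

-- Reachability under a decidable relation on Fin n: grow the set of vertices
-- known to be reachable until it is closed.
star? : ∀ {n ℓ} {R : Fin n → Fin n → Set ℓ} →
  (∀ x y → Dec (R x y)) → ∀ u v → Dec (Star R u v)
star? {n} {R = R} R? u v =
  let K , u∈K , sound , closed = grow n (λ x → does (u ≟ x)) start-sound
                                  (dec-true (u ≟ u) refl) (m≤m+n n _)
  in decide K u∈K sound closed
  where
  Sound : (Fin n → Bool) → Set _
  Sound K = ∀ {x} → K x ≡ true → Star R u x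

  Closed : (Fin n → Bool) → Set _
  Closed K = ∀ {x y} → K x ≡ true → R x y → K y ≡ true

  start-sound : Sound (λ x → does (u ≟ x))
  start-sound {x} eq with does⇒ (u ≟ x) eq
  ... | refl = ε

  frontier? : ∀ K → Dec (∃[ y ] ∃[ x ] (K x ≡ true × K y ≡ false) × R x y)
  frontier? K = any? λ y → any? λ x →
    ((K x Bool.≟ true) ×-dec (K y Bool.≟ false)) ×-dec R? x y

  add : Fin n → (Fin n → Bool) → Fin n → Bool
  add y K z = does (y ≟ z) ∨ K z

  size-add : ∀ y K → K y ≡ false → sum (ι ∘ add y K) ≡ suc (sum (ι ∘ K))
  size-add y K y∉K = begin
    sum (ι ∘ add y K)                ≡⟨ sum-cong-≗ pointwise ⟩
    sum (λ z → [ y ≐ z ] + ι (K z))  ≡⟨ ∑-distrib-+ [ y ≐_] (ι ∘ K) ⟩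
    sum [ y ≐_] + sum (ι ∘ K)        ≡⟨ cong (_+ sum (ι ∘ K)) (sum-≐ y) ⟩
    suc (sum (ι ∘ K))                ∎
    where
    open ≡-Reasoning
    pointwise : ∀ z → ι (add y K z) ≡ [ y ≐ z ] + ι (K z)
    pointwise z with y ≟ z
    ... | yes refl rewrite y∉K = refl
    ... | no _ = refl

  size≤n : (K : Fin n → Bool) → sum (ι ∘ K) ≤ n
  size≤n K = ≤-trans (sum-mono ι≤1) (≤-reflexive (trans (sum-const n 1) (*-identityʳ n)))
    where
    ι≤1 : ∀ i → ι (K i) ≤ 1
    ι≤1 i with K i
    ... | true  = ≤-refl
    ... | false = z≤n

  grow : ∀ k K → Sound K → K u ≡ true → n ≤ k + sum (ι ∘ K) →
    ∃[ K′ ] K′ u ≡ true × Sound K′ × Closed K′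
  grow k K sound u∈K n≤ with frontier? K
  ... | no none = K , u∈K , sound , λ {x} {y} x∈K xRy → closed x∈K xRy
    where
    closed : Closed K
    closed {x} {y} x∈K xRy with K y in eq
    ... | true  = refl
    ... | false = contradiction (y , x , (x∈K , eq) , xRy) none
  ... | yes (y , x , (x∈K , y∉K) , xRy) with k
  -- The fuel `k` bounds the number of vertices outside `K`; at zero all `n` vertices are in `K`,
  -- and adding `y` would give more than `n`.
  ...   | zero  = contradiction
    (≤-trans (s≤s n≤) (≤-trans (≤-reflexive (sym (size-add y K y∉K))) (size≤n (add y K))))
    (<-irrefl refl)
  ...   | suc k = grow k (add y K) sound′ u∈K′
    (≤-trans n≤ (≤-reflexive (sym (trans (cong (k +_) (size-add y K y∉K)) (+-suc k _)))))
    where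
    sound′ : Sound (add y K)
    sound′ {z} z∈K′ with y ≟ z
    ... | yes refl = sound x∈K ◅◅ (xRy ◅ ε)
    ... | no _     = sound z∈K′
    u∈K′ : add y K u ≡ true
    u∈K′ rewrite u∈K = Bool.∨-zeroʳ _

  decide : ∀ K → K u ≡ true → Sound K → Closed K → Dec (Star R u v)
  decide K u∈K sound closed with K v in eq
  ... | true  = yes (sound eq)
  ... | false = no λ w → true≢false (stays u∈K w) eq
    where
    stays : ∀ {x y} → K x ≡ true → Star R x y → K y ≡ true
    stays x∈K ε       = x∈K
    stays x∈K (r ◅ w) = stays (closed x∈K r) w

crossing : ∀ {a ℓ} {A : Set a} {R : A → A → Set ℓ} (P : A → Bool) {u v} →
  Star R u v → P u ≡ true → P v ≡ false → ∃[ x ] ∃[ y ] R x y × P x ≡ true × P y ≡ false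
crossing P ε u∈P u∉P = contradiction u∉P (true≢false u∈P)
crossing P (_◅_ {j = w} r walk) u∈P v∉P with P w in eq
... | false = _ , _ , r , u∈P , eq
... | true  = crossing P walk eq v∉P

-- A common 2-colouring of two matchings.

-- Two matchings can be properly 2-coloured at once.  One of them is the
-- fixed-point-free involution σ.  An edge xy of the other one is processed by
-- replacing the pairs {x, σ x}, {y, σ y} of σ with {x, y}, {σ x, σ y}, colouring
-- the rest, and then recolouring x and y to differ from their old partners.
two-colouring : ∀ {n} m (M : Fin m → Bool) (a b : Fin m → Fin n) →
  (∀ {i} → M i ≡ true → a i ≢ b i) →
  (∀ {i j v} → M i ≡ true → M j ≡ true →
    a i ≡ v ⊎ b i ≡ v → a j ≡ v ⊎ b j ≡ v → i ≡ j) →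
  (σ : Fin n → Fin n) → (∀ v → σ (σ v) ≡ v) → (∀ v → σ v ≢ v) →
  Σ[ c ∈ (Fin n → Bool) ] (∀ v → c (σ v) ≡ not (c v)) × (∀ {i} → M i ≡ true → c (b i) ≡ not (c (a i)))
two-colouring zero M a b _ _ σ σσ σ≢ = c , c-σ , λ {}
  where
  -- With no edge of `M` left, the smaller vertex of each pair of `σ` gets `true`.
  c : _ → Bool
  c v = does (v Fin.<? σ v)
  c-σ : ∀ v → c (σ v) ≡ not (c v)
  c-σ v rewrite σσ v with Fin.<-cmp v (σ v)
  ... | tri< lt _ gt = trans (dec-false (σ v Fin.<? v) gt) (cong not (sym (dec-true (v Fin.<? σ v) lt)))
  ... | tri≈ _ eq _ = contradiction (sym eq) (σ≢ v)
  ... | tri> lt _ gt = trans (dec-true (σ v Fin.<? v) gt) (cong not (sym (dec-false (v Fin.<? σ v) lt)))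
two-colouring {n} (suc m) M a b loopless disjoint σ σσ σ≢ with M zero in x∼y
... | false =
  let c , c-σ , c-M = two-colouring m (M ∘ suc) (a ∘ suc) (b ∘ suc) loopless
                        (λ p q r s → suc-injective (disjoint p q r s)) σ σσ σ≢
  in c , c-σ , λ { {zero}  0∈M → contradiction x∼y (true≢false 0∈M)
                 ; {suc i} i∈M → c-M i∈M }
... | true with σ (a zero) ≟ b zero
...   | yes σx≡y =
  let c , c-σ , c-M = two-colouring m (M ∘ suc) (a ∘ suc) (b ∘ suc) loopless
                        (λ p q r s → suc-injective (disjoint p q r s)) σ σσ σ≢
  in c , c-σ , λ { {zero}  _   → trans (cong c (sym σx≡y)) (c-σ (a zero))
                 ; {suc i} i∈M → c-M i∈M }
...   | no σx≢y = recolour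
  where
  x y x′ y′ : Fin n
  x  = a zero
  y  = b zero
  x′ = σ x
  y′ = σ y

  σ-injective : ∀ {u v} → σ u ≡ σ v → u ≡ v
  σ-injective {u} {v} eq = trans (sym (σσ u)) (trans (cong σ eq) (σσ v))

  x≢y : x ≢ y
  x≢y = loopless x∼y
  y′≢x : y′ ≢ x
  y′≢x eq = σx≢y (trans (cong σ (sym eq)) (σσ y))

  σ′ : Fin n → Fin n
  σ′ v with v ≟ x
  ... | yes _ = y
  ... | no _ with v ≟ y
  ...   | yes _ = x
  ...   | no _ with v ≟ x′
  ...     | yes _ = y′
  ...     | no _ with v ≟ y′
  ...       | yes _ = x′
  ...       | no _  = σ v

  data View : Fin n → Set where
    is-x  : View x
    is-y  : View y
    is-x′ : View x′
    is-y′ : View y′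
    other : ∀ {v} → v ≢ x → v ≢ y → v ≢ x′ → v ≢ y′ → View v

  view : ∀ v → View v
  view v with v ≟ x | v ≟ y | v ≟ x′ | v ≟ y′
  ... | yes refl | _ | _ | _ = is-x
  ... | no _ | yes refl | _ | _ = is-y
  ... | no _ | no _ | yes refl | _ = is-x′
  ... | no _ | no _ | no _ | yes refl = is-y′
  ... | no p | no q | no r | no s = other p q r s

  σ′x : σ′ x ≡ y
  σ′x with x ≟ x
  ... | yes _ = refl
  ... | no x≢x = contradiction refl x≢x

  σ′y : σ′ y ≡ x
  σ′y with y ≟ x
  ... | yes y≡x = contradiction (sym y≡x) x≢y
  ... | no _ with y ≟ y
  ...   | yes _ = refl
  ...   | no y≢y = contradiction refl y≢y

  σ′x′ : σ′ x′ ≡ y′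
  σ′x′ with x′ ≟ x
  ... | yes x′≡x = contradiction x′≡x (σ≢ x)
  ... | no _ with x′ ≟ y
  ...   | yes x′≡y = contradiction x′≡y σx≢y
  ...   | no _ with x′ ≟ x′
  ...     | yes _ = refl
  ...     | no x′≢x′ = contradiction refl x′≢x′

  σ′y′ : σ′ y′ ≡ x′
  σ′y′ with y′ ≟ x
  ... | yes y′≡x = contradiction y′≡x y′≢x
  ... | no _ with y′ ≟ y
  ...   | yes y′≡y = contradiction y′≡y (σ≢ y)
  ...   | no _ with y′ ≟ x′
  ...     | yes y′≡x′ = contradiction (σ-injective (sym y′≡x′)) x≢y
  ...     | no _ with y′ ≟ y′
  ...       | yes _ = refl
  ...       | no y′≢y′ = contradiction refl y′≢y′

  σ′-other : ∀ {v} → v ≢ x → v ≢ y → v ≢ x′ → v ≢ y′ → σ′ v ≡ σ v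
  σ′-other {v} v≢x v≢y v≢x′ v≢y′ with v ≟ x
  ... | yes eq = contradiction eq v≢x
  ... | no _ with v ≟ y
  ...   | yes eq = contradiction eq v≢y
  ...   | no _ with v ≟ x′
  ...     | yes eq = contradiction eq v≢x′
  ...     | no _ with v ≟ y′
  ...       | yes eq = contradiction eq v≢y′
  ...       | no _  = refl

  σ-flip : ∀ {u v} → u ≢ σ v → σ u ≢ v
  σ-flip {u} u≢σv σu≡v = u≢σv (trans (sym (σσ u)) (cong σ σu≡v))

  σ′σ′ : ∀ v → σ′ (σ′ v) ≡ v
  σ′σ′ v with view v
  ... | is-x  = trans (cong σ′ σ′x) σ′y
  ... | is-y  = trans (cong σ′ σ′y) σ′x
  ... | is-x′ = trans (cong σ′ σ′x′) σ′y′
  ... | is-y′ = trans (cong σ′ σ′y′) σ′x′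
  ... | other p q r s = trans (cong σ′ (σ′-other p q r s))
    (trans (σ′-other (σ-flip r) (σ-flip s) (p ∘ σ-injective) (q ∘ σ-injective)) (σσ v))

  σ′≢ : ∀ v → σ′ v ≢ v
  σ′≢ v with view v
  ... | is-x  = λ eq → x≢y (sym (trans (sym σ′x) eq))
  ... | is-y  = λ eq → x≢y (trans (sym σ′y) eq)
  ... | is-x′ = λ eq → x≢y (sym (σ-injective (trans (sym σ′x′) eq)))
  ... | is-y′ = λ eq → x≢y (σ-injective (trans (sym σ′y′) eq))
  ... | other p q r s = λ eq → σ≢ v (trans (sym (σ′-other p q r s)) eq)

  recolour : Σ[ c ∈ (Fin n → Bool) ] (∀ v → c (σ v) ≡ not (c v)) ×
    (∀ {i} → M i ≡ true → c (b i) ≡ not (c (a i)))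
  recolour with two-colouring m (M ∘ suc) (a ∘ suc) (b ∘ suc) loopless
                  (λ p q r s → suc-injective (disjoint p q r s)) σ′ σ′σ′ σ′≢
  ... | c , c-σ′ , c-M = d , d-σ , d-M
    where
    d : Fin n → Bool
    d v with v ≟ x
    ... | yes _ = not (c x′)
    ... | no _ with v ≟ y
    ...   | yes _ = not (c y′)
    ...   | no _  = c v

    d-x : d x ≡ not (c x′)
    d-x with x ≟ x
    ... | yes _ = refl
    ... | no x≢x = contradiction refl x≢x

    d-y : d y ≡ not (c y′)
    d-y with y ≟ x
    ... | yes y≡x = contradiction (sym y≡x) x≢y
    ... | no _ with y ≟ y
    ...   | yes _ = refl
    ...   | no y≢y = contradiction refl y≢y

    d-other : ∀ {v} → v ≢ x → v ≢ y → d v ≡ c v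
    d-other {v} v≢x v≢y with v ≟ x
    ... | yes eq = contradiction eq v≢x
    ... | no _ with v ≟ y
    ...   | yes eq = contradiction eq v≢y
    ...   | no _ = refl

    d-x′ : d x′ ≡ c x′
    d-x′ = d-other (σ≢ x) σx≢y
    d-y′ : d y′ ≡ c y′
    d-y′ = d-other y′≢x (σ≢ y)

    d-σ : ∀ v → d (σ v) ≡ not (d v)
    d-σ v with view v
    ... | is-x  = trans d-x′ (trans (sym (Bool.not-involutive _)) (cong not (sym d-x)))
    ... | is-y  = trans d-y′ (trans (sym (Bool.not-involutive _)) (cong not (sym d-y)))
    ... | is-x′ = trans (cong d (σσ x)) (trans d-x (cong not (sym d-x′)))
    ... | is-y′ = trans (cong d (σσ y)) (trans d-y (cong not (sym d-y′)))
    ... | other p q r s = trans (d-other (σ-flip r) (σ-flip s))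
      (trans (cong c (sym (σ′-other p q r s))) (trans (c-σ′ v) (cong not (sym (d-other p q)))))

    d-M : ∀ {i} → M i ≡ true → d (b i) ≡ not (d (a i))
    -- `σ′` pairs `x′` with `y′`, so `c` differs on these two, and hence the negated colours given
    -- to `x` and `y` differ as well.
    d-M {zero} _ = begin
      d y            ≡⟨ d-y ⟩
      not (c y′)     ≡⟨ cong (not ∘ c) (sym σ′x′) ⟩
      not (c (σ′ x′)) ≡⟨ cong not (c-σ′ x′) ⟩
      not (not (c x′)) ≡⟨ cong not (sym d-x) ⟩
      not (d x)      ∎
      where open ≡-Reasoning
    -- By disjointness no other edge of `M` meets `x` or `y`, the only vertices where `d` may differ
    -- from `c`.
    d-M {suc i} i∈M = trans (d-other (≢-0 (inj₂ refl) (inj₁ refl)) (≢-0 (inj₂ refl) (inj₂ refl)))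
      (trans (c-M i∈M) (cong not (sym
        (d-other (≢-0 (inj₁ refl) (inj₁ refl)) (≢-0 (inj₁ refl) (inj₂ refl))))))
      where
      ≢-0 : ∀ {u v} → a (suc i) ≡ u ⊎ b (suc i) ≡ u → x ≡ v ⊎ y ≡ v → u ≢ v
      ≢-0 at-u at-v refl with () ← disjoint i∈M x∼y at-u at-v

-- Double counting over edges and their ends.

module Loads (G : Graph) where
  open Graph G

  -- One notion for degrees and for token holdings: taking both `s` and `t` to be the indicator of
  -- an edge set gives the degree, taking them to be the two halves of a split gives the tokens at
  -- `v`. All double counts below are instances of `∑-*-load`.
  load : (s t : Fin #E → ℕ) → Fin #V → ℕ
  load s t v = sum λ e → [ end₁ e ≐ v ] * s e + [ end₂ e ≐ v ] * t e

  ∑-*-load : ∀ x s t →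
    sum (λ v → x v * load s t v) ≡ sum (λ e → x (end₁ e) * s e + x (end₂ e) * t e)
  ∑-*-load x s t = begin
    sum (λ v → x v * load s t v)
      ≡⟨ sum-cong-≗ (λ v → *-distribˡ-sum (x v) (λ e → [ end₁ e ≐ v ] * s e + [ end₂ e ≐ v ] * t e)) ⟩
    sum (λ v → sum λ e → x v * ([ end₁ e ≐ v ] * s e + [ end₂ e ≐ v ] * t e))
      ≡⟨ ∑-comm (λ v e → x v * ([ end₁ e ≐ v ] * s e + [ end₂ e ≐ v ] * t e)) ⟩
    sum (λ e → sum λ v → x v * ([ end₁ e ≐ v ] * s e + [ end₂ e ≐ v ] * t e))
      ≡⟨ sum-cong-≗ collect ⟩
    sum (λ e → x (end₁ e) * s e + x (end₂ e) * t e) ∎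
    where
    open ≡-Reasoning
    rearrange : ∀ X A S B T → X * (A * S + B * T) ≡ S * (X * A) + T * (X * B)
    rearrange = solve-∀
    collect : ∀ e → sum (λ v → x v * ([ end₁ e ≐ v ] * s e + [ end₂ e ≐ v ] * t e))
      ≡ x (end₁ e) * s e + x (end₂ e) * t e
    collect e = begin
      sum (λ v → x v * ([ end₁ e ≐ v ] * s e + [ end₂ e ≐ v ] * t e))
        ≡⟨ sum-cong-≗ (λ v → rearrange (x v) [ end₁ e ≐ v ] (s e) [ end₂ e ≐ v ] (t e)) ⟩
      sum (λ v → s e * (x v * [ end₁ e ≐ v ]) + t e * (x v * [ end₂ e ≐ v ]))
        ≡⟨ ∑-distrib-+ (λ v → s e * (x v * [ end₁ e ≐ v ])) (λ v → t e * (x v * [ end₂ e ≐ v ])) ⟩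
      sum (λ v → s e * (x v * [ end₁ e ≐ v ])) + sum (λ v → t e * (x v * [ end₂ e ≐ v ]))
        ≡⟨ cong₂ _+_ (*-distribˡ-sum (s e) (λ v → x v * [ end₁ e ≐ v ]))
                     (*-distribˡ-sum (t e) (λ v → x v * [ end₂ e ≐ v ])) ⟨
      s e * sum (λ v → x v * [ end₁ e ≐ v ]) + t e * sum (λ v → x v * [ end₂ e ≐ v ])
        ≡⟨ cong₂ _+_ (cong (s e *_) (sum-*≐ x (end₁ e))) (cong (t e *_) (sum-*≐ x (end₂ e))) ⟩
      s e * x (end₁ e) + t e * x (end₂ e)
        ≡⟨ cong₂ _+_ (*-comm (s e) _) (*-comm (t e) _) ⟩
      x (end₁ e) * s e + x (end₂ e) * t e ∎

  -- One unit of `e` passes from its first end to its second. The hypotheses are additive, without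
  -- subtraction, so the equation read backwards also covers the opposite move.
  load-shift : ∀ {s t s′ t′} e →
    (∀ f → s′ f + [ e ≐ f ] ≡ s f) → (∀ f → t f + [ e ≐ f ] ≡ t′ f) →
    ∀ v → load s′ t′ v + [ end₁ e ≐ v ] ≡ load s t v + [ end₂ e ≐ v ]
  load-shift {s} {t} {s′} {t′} e s≡ t≡ v = begin
    load s′ t′ v + [ end₁ e ≐ v ]
      ≡⟨ cong (load s′ t′ v +_) (sum-*≐ (λ f → [ end₁ f ≐ v ]) e) ⟨
    load s′ t′ v + sum (λ f → [ end₁ f ≐ v ] * [ e ≐ f ])
      ≡⟨ ∑-distrib-+ (λ f → [ end₁ f ≐ v ] * s′ f + [ end₂ f ≐ v ] * t′ f) (λ f → [ end₁ f ≐ v ] * [ e ≐ f ]) ⟨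
    sum (λ f → [ end₁ f ≐ v ] * s′ f + [ end₂ f ≐ v ] * t′ f + [ end₁ f ≐ v ] * [ e ≐ f ])
      ≡⟨ sum-cong-≗ pointwise ⟩
    sum (λ f → [ end₁ f ≐ v ] * s f + [ end₂ f ≐ v ] * t f + [ end₂ f ≐ v ] * [ e ≐ f ])
      ≡⟨ ∑-distrib-+ (λ f → [ end₁ f ≐ v ] * s f + [ end₂ f ≐ v ] * t f) (λ f → [ end₂ f ≐ v ] * [ e ≐ f ]) ⟩
    load s t v + sum (λ f → [ end₂ f ≐ v ] * [ e ≐ f ])
      ≡⟨ cong (load s t v +_) (sum-*≐ (λ f → [ end₂ f ≐ v ]) e) ⟩
    load s t v + [ end₂ e ≐ v ] ∎
    where
    open ≡-Reasoning
    move : ∀ A B S T D → A * S + B * (T + D) + A * D ≡ A * (S + D) + B * T + B * D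
    move = solve-∀
    pointwise : ∀ f →
      [ end₁ f ≐ v ] * s′ f + [ end₂ f ≐ v ] * t′ f + [ end₁ f ≐ v ] * [ e ≐ f ] ≡
      [ end₁ f ≐ v ] * s f + [ end₂ f ≐ v ] * t f + [ end₂ f ≐ v ] * [ e ≐ f ]
    pointwise f rewrite sym (s≡ f) | sym (t≡ f) =
      move [ end₁ f ≐ v ] [ end₂ f ≐ v ] (s′ f) (t f) [ e ≐ f ]

  #inside : (Fin #V → Bool) → ℕ
  #inside X = sum λ e → ι (X (end₁ e) ∧ X (end₂ e))

length : ∀ {a ℓ} {A : Set a} {R : A → A → Set ℓ} {u v} → Star R u v → ℕ
length ε       = 0
length (_ ◅ w) = suc (length w)

-- Token distributions with prescribed vertex totals.

-- Hakimi's theorem: every edge shares c tokens between its two ends, and the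
-- vertices can be made to hold prescribed numbers β of tokens unless the edges
-- inside some X already carry more than β allows.  Tokens are pushed along
-- walks of the residual relation from a vertex with too many to one with too few.
module Distribution (G : Graph) (c : ℕ) where
  open Graph G
  open Loads G

  record Split : Set where
    field
      tokens₁ tokens₂ : Fin #E → ℕ
      total           : ∀ e → tokens₁ e + tokens₂ e ≡ c

    holds : Fin #V → ℕ
    holds = load tokens₁ tokens₂

    Residual : Fin #V → Fin #V → Set
    Residual u v = ∃[ e ] (((end₁ e ≡ u × end₂ e ≡ v) × 0 < tokens₁ e)
                         ⊎ ((end₂ e ≡ u × end₁ e ≡ v) × 0 < tokens₂ e))

    residual? : ∀ u v → Dec (Residual u v)
    residual? u v = any? λ e →
      (((end₁ e ≟ u) ×-dec (end₂ e ≟ v)) ×-dec (0 <? tokens₁ e)) ⊎-dec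
      (((end₂ e ≟ u) ×-dec (end₁ e ≟ v)) ×-dec (0 <? tokens₂ e))

    ∑holds : sum holds ≡ #E * c
    ∑holds = begin
      sum holds                       ≡⟨ sum-cong-≗ (λ v → sym (*-identityˡ (holds v))) ⟩
      sum (λ v → 1 * holds v)         ≡⟨ ∑-*-load (λ _ → 1) tokens₁ tokens₂ ⟩
      sum (λ e → 1 * tokens₁ e + 1 * tokens₂ e) ≡⟨ sum-cong-≗ (λ e →
        trans (cong₂ _+_ (*-identityˡ (tokens₁ e)) (*-identityˡ (tokens₂ e))) (total e)) ⟩
      sum {#E} (λ _ → c)              ≡⟨ sum-const #E c ⟩
      #E * c                          ∎
      where open ≡-Reasoning

  open Split

  take : (Fin #E → ℕ) → Fin #E → Fin #E → ℕ
  take s e f = s f ∸ [ e ≐ f ]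

  take+ : ∀ s e → 0 < s e → ∀ f → take s e f + [ e ≐ f ] ≡ s f
  take+ s e 0<se f with e ≟ f
  ... | yes refl = m∸n+n≡m 0<se
  ... | no _     = +-identityʳ (s f)

  take-≥ : ∀ s e {f} → e ≢ f → s f ≤ take s e f
  take-≥ s e e≢f rewrite ≐-≢ e≢f = ≤-refl

  -- The `keeps` fields record that only residual arcs out of `u` can be lost; this is all that
  -- `transfer` needs in order to keep the rest of a walk usable.
  record Step (p : Split) (u v : Fin #V) : Set where
    field
      q      : Split
      holds≡ : ∀ x → holds q x + [ u ≐ x ] ≡ holds p x + [ v ≐ x ]
      keeps₁ : ∀ f → end₁ f ≢ u → tokens₁ p f ≤ tokens₁ q f
      keeps₂ : ∀ f → end₂ f ≢ u → tokens₂ p f ≤ tokens₂ q f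

  move-token : ∀ {a b d} x → a + x ≡ b → b + d ≡ c → a + (d + x) ≡ c
  move-token {a} {b} {d} x a+x≡b b+d≡c = begin
    a + (d + x) ≡⟨ cong (a +_) (+-comm d x) ⟩
    a + (x + d) ≡⟨ +-assoc a x d ⟨
    a + x + d   ≡⟨ cong (_+ d) a+x≡b ⟩
    b + d       ≡⟨ b+d≡c ⟩
    c           ∎
    where open ≡-Reasoning

  step : ∀ p {u v} → Residual p u v → Step p u v
  step p (e , inj₁ ((refl , refl) , 0<s)) = record
    { q = record
      { tokens₁ = take (tokens₁ p) e
      ; tokens₂ = λ f → tokens₂ p f + [ e ≐ f ]
      ; total   = λ f → move-token [ e ≐ f ] (take+ (tokens₁ p) e 0<s f) (total p f)
      }
    ; holds≡ = load-shift e (take+ (tokens₁ p) e 0<s) (λ _ → refl)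
    ; keeps₁ = λ f f≢u → take-≥ (tokens₁ p) e λ { refl → f≢u refl }
    ; keeps₂ = λ f _ → m≤m+n _ _
    }
  step p (e , inj₂ ((refl , refl) , 0<t)) = record
    { q = record
      { tokens₁ = λ f → tokens₁ p f + [ e ≐ f ]
      ; tokens₂ = take (tokens₂ p) e
      ; total   = λ f → trans (+-comm (tokens₁ p f + [ e ≐ f ]) _)
          (move-token [ e ≐ f ] (take+ (tokens₂ p) e 0<t f)
            (trans (+-comm (tokens₂ p f) _) (total p f)))
      }
    ; holds≡ = λ x → sym (load-shift e (λ _ → refl) (take+ (tokens₂ p) e 0<t) x)
    ; keeps₁ = λ f _ → m≤m+n _ _
    ; keeps₂ = λ f f≢u → take-≥ (tokens₂ p) e λ { refl → f≢u refl }
    }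

  -- A push out of u can only invalidate later steps out of u, and these can be
  -- short-cut.
  transfer : ∀ {p u v} (st : Step p u v) {x y} (w : Star (Residual p) x y) →
    (Σ[ w′ ∈ Star (Residual p) u y ] length w′ ≤ length w) ⊎
    (Σ[ w′ ∈ Star (Residual (Step.q st)) x y ] length w′ ≤ length w)
  transfer st ε = inj₂ (ε , z≤n)
  transfer {p} {u} st {x} (r ◅ w) with x ≟ u
  ... | yes refl = inj₁ (r ◅ w , ≤-refl)
  ... | no x≢u with transfer st w
  ...   | inj₁ (w′ , ≤w) = inj₁ (w′ , m≤n⇒m≤1+n ≤w)
  ...   | inj₂ (w′ , ≤w) = inj₂ (lift r ◅ w′ , s≤s ≤w)
    where
    open Step st
    lift : ∀ {z} → Residual p x z → Residual q x z
    lift (f , inj₁ ((refl , eq) , 0<s)) = f , inj₁ ((refl , eq) , ≤-trans 0<s (keeps₁ f x≢u))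
    lift (f , inj₂ ((refl , eq) , 0<t)) = f , inj₂ ((refl , eq) , ≤-trans 0<t (keeps₂ f x≢u))

  -- The bound `k` replaces structural recursion, since `transfer` rebuilds the walk. If the rest of
  -- the walk returns to `u`, the first step is not made at all and the walk is short-cut in the old
  -- split.
  push : ∀ k p {u v} (w : Star (Residual p) u v) → length w ≤ k →
    ∃[ q ] ∀ x → holds q x + [ u ≐ x ] ≡ holds p x + [ v ≐ x ]
  push k p ε _ = p , λ _ → refl
  push (suc k) p {u} {v} (_◅_ {j = z} r w) (s≤s ≤k) with transfer (step p r) w
  ... | inj₁ (w′ , ≤w) = push k p w′ (≤-trans ≤w ≤k)
  ... | inj₂ (w′ , ≤w) =
    let q′ , holds≡′ = push k q w′ (≤-trans ≤w ≤k)
    in q′ , λ x → +-cancelʳ-≡ [ z ≐ x ] _ _ (begin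
      holds q′ x + [ u ≐ x ] + [ z ≐ x ] ≡⟨ swap (holds q′ x) [ u ≐ x ] [ z ≐ x ] ⟩
      holds q′ x + [ z ≐ x ] + [ u ≐ x ] ≡⟨ cong (_+ [ u ≐ x ]) (holds≡′ x) ⟩
      holds q x + [ v ≐ x ] + [ u ≐ x ]  ≡⟨ swap (holds q x) [ v ≐ x ] [ u ≐ x ] ⟩
      holds q x + [ u ≐ x ] + [ v ≐ x ]  ≡⟨ cong (_+ [ v ≐ x ]) (holds≡ x) ⟩
      holds p x + [ z ≐ x ] + [ v ≐ x ]  ≡⟨ swap (holds p x) [ z ≐ x ] [ v ≐ x ] ⟩
      holds p x + [ v ≐ x ] + [ z ≐ x ]  ∎)
    where
    open Step (step p r)
    open ≡-Reasoning
    swap : ∀ a b d → a + b + d ≡ a + d + b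
    swap = solve-∀

  module _ (β : Fin #V → ℕ) (∑β : sum β ≡ #E * c)
           (inside≤β : ∀ X → c * #inside X ≤ sum (λ v → ι (X v) * β v)) where

    surplus : Split → ℕ
    surplus p = sum λ v → holds p v ∸ β v

    -- The token lost at `u` was in excess, and the one gained at `v` stays within its quota, where
    -- truncated subtraction does not see it.
    surplus-decreases : ∀ {p q u v} → β u < holds p u → holds p v < β v →
      (∀ x → holds q x + [ u ≐ x ] ≡ holds p x + [ v ≐ x ]) → surplus q < surplus p
    surplus-decreases {p} {q} {u} {v} u-over v-under holds≡ = begin
      suc (surplus q)                                ≡⟨ +-comm 1 (surplus q) ⟩
      surplus q + 1                                  ≡⟨ cong (surplus q +_) (sum-≐ u) ⟨
      surplus q + sum [ u ≐_]                        ≡⟨ ∑-distrib-+ (λ x → holds q x ∸ β x) [ u ≐_] ⟨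
      sum (λ x → holds q x ∸ β x + [ u ≐ x ])        ≤⟨ sum-mono pointwise ⟩
      surplus p                                      ∎
      where
      open ≤-Reasoning
      pointwise : ∀ x → holds q x ∸ β x + [ u ≐ x ] ≤ holds p x ∸ β x
      pointwise x with holds≡ x
      ... | eq with u ≟ x | v ≟ x
      ...   | yes refl | yes refl = contradiction u-over (<-asym v-under)
      ...   | no _     | no _     = ≤-reflexive
        (trans (+-identityʳ _) (cong (_∸ β x) (+-cancelʳ-≡ 0 _ _ eq)))
      ...   | no _     | yes refl = ≤-trans (≤-reflexive (trans (+-identityʳ _)
        (m≤n⇒m∸n≡0 (≤-trans (≤-reflexive (trans (sym (+-identityʳ _))
          (trans eq (+-comm (holds p x) 1)))) v-under)))) z≤n
      ...   | yes refl | no _     = ≤-reflexive (begin-equality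
        holds q x ∸ β x + 1   ≡⟨ +-comm (holds q x ∸ β x) 1 ⟩
        1 + (holds q x ∸ β x) ≡⟨ +-∸-assoc 1 (≤-pred (≤-trans u-over (≤-reflexive p≡1+q))) ⟨
        suc (holds q x) ∸ β x ≡⟨ cong (_∸ β x) p≡1+q ⟨
        holds p x ∸ β x       ∎)
        where
        p≡1+q : holds p x ≡ suc (holds q x)
        p≡1+q = trans (sym (+-identityʳ _)) (trans (sym eq) (+-comm (holds q x) 1))

    -- The min-cut argument. Let `K` be the set reachable from the overfull `u`. An edge with one
    -- end in `K` has no token at that end, since otherwise its other end would be reachable too; so
    -- `K` holds at most `c` tokens for each edge inside it, hence at most its total quota. But no
    -- vertex of `K` is below its quota and `u` is above.
    stuck : ∀ p u → β u < holds p u → ¬ (∃[ v ] holds p v < β v × Star (Residual p) u v)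
      → ∀ {a} {A : Set a} → A
    stuck p u u-over none = contradiction overfull (<-irrefl refl)
      where
      K : Fin #V → Bool
      K v = does (star? (residual? p) u v)

      K-step : ∀ {x y} → K x ≡ true → Residual p x y → K y ≡ true
      K-step {x} {y} x∈K r =
        dec-true (star? (residual? p) u y) (does⇒ (star? (residual? p) u x) x∈K ◅◅ (r ◅ ε))

      ∑K-< : sum (λ v → ι (K v) * β v) < sum (λ v → ι (K v) * holds p v)
      ∑K-< = begin
        suc (sum (λ v → ι (K v) * β v))              ≡⟨ +-comm 1 _ ⟩
        sum (λ v → ι (K v) * β v) + 1                ≡⟨ cong (sum (λ v → ι (K v) * β v) +_) (sum-≐ u) ⟨
        sum (λ v → ι (K v) * β v) + sum [ u ≐_]      ≡⟨ ∑-distrib-+ (λ v → ι (K v) * β v) [ u ≐_] ⟨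
        sum (λ v → ι (K v) * β v + [ u ≐ v ])        ≤⟨ sum-mono pointwise ⟩
        sum (λ v → ι (K v) * holds p v)              ∎
        where
        open ≤-Reasoning
        pointwise : ∀ v → ι (K v) * β v + [ u ≐ v ] ≤ ι (K v) * holds p v
        pointwise v with u ≟ v
        ... | yes refl
          rewrite dec-true (star? (residual? p) u u) ε | +-identityʳ (β u) | +-identityʳ (holds p u) =
          ≤-trans (≤-reflexive (+-comm (β u) 1)) u-over
        ... | no _ with K v in v∈K
        ...   | false = z≤n
        ...   | true rewrite +-identityʳ (β v) | +-identityʳ (holds p v) | +-identityʳ (β v) =
          ≮⇒≥ λ v-under → none (v , v-under , does⇒ (star? (residual? p) u v) v∈K)

      K-edge : ∀ e → ι (K (end₁ e)) * tokens₁ p e + ι (K (end₂ e)) * tokens₂ p e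
        ≤ c * ι (K (end₁ e) ∧ K (end₂ e))
      K-edge e with K (end₁ e) in eq₁ | K (end₂ e) in eq₂
      ... | true  | true  = ≤-reflexive (trans
        (cong₂ _+_ (+-identityʳ (tokens₁ p e)) (+-identityʳ (tokens₂ p e)))
        (trans (total p e) (sym (*-identityʳ c))))
      ... | false | false = z≤n
      ... | true  | false with tokens₁ p e in eq
      ...   | zero  = z≤n
      ...   | suc _ = contradiction eq₂
        (true≢false (K-step eq₁ (e , inj₁ ((refl , refl) , subst (0 <_) (sym eq) (s≤s z≤n)))))
      K-edge e | false | true with tokens₂ p e in eq
      ...   | zero  = z≤n
      ...   | suc _ = contradiction eq₁
        (true≢false (K-step eq₂ (e , inj₂ ((refl , refl) , subst (0 <_) (sym eq) (s≤s z≤n)))))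

      overfull : sum (λ v → ι (K v) * β v) < sum (λ v → ι (K v) * β v)
      overfull = begin-strict
        sum (λ v → ι (K v) * β v)
          <⟨ ∑K-< ⟩
        sum (λ v → ι (K v) * holds p v)
          ≡⟨ ∑-*-load (ι ∘ K) (tokens₁ p) (tokens₂ p) ⟩
        sum (λ e → ι (K (end₁ e)) * tokens₁ p e + ι (K (end₂ e)) * tokens₂ p e)
          ≤⟨ sum-mono K-edge ⟩
        sum (λ e → c * ι (K (end₁ e) ∧ K (end₂ e)))
          ≡⟨ *-distribˡ-sum c (λ e → ι (K (end₁ e) ∧ K (end₂ e))) ⟨
        c * #inside K
          ≤⟨ inside≤β K ⟩
        sum (λ v → ι (K v) * β v) ∎
        where open ≤-Reasoning

    improve : ∀ k p → surplus p ≤ k → ∃[ q ] ∀ v → holds q v ≡ β v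
    improve k p ≤k with any? (λ v → β v <? holds p v)
    -- No vertex is overfull and the totals agree, so none is underfull either.
    ... | no none = p ,
      sum-pointwise-≡ (λ v → ≮⇒≥ λ over → none (v , over)) (trans (∑holds p) (sym ∑β))
    ... | yes (u , u-over)
      with any? (λ v → (holds p v <? β v) ×-dec star? (residual? p) u v)
    ...   | no none = stuck p u u-over none
    ...   | yes (v , v-under , w) with push (length w) p w ≤-refl
    ...     | q , holds≡ with k
    ...       | zero  = contradiction (≤-trans (surplus-decreases {p} {q} u-over v-under holds≡) ≤k) λ ()
    ...       | suc k = improve k q (≤-pred (≤-trans (surplus-decreases {p} {q} u-over v-under holds≡) ≤k))

    distribution : ∃[ q ] ∀ v → holds q v ≡ β v
    distribution = improve (surplus p₀) p₀ ≤-refl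
      where
      p₀ : Split
      p₀ = record { tokens₁ = λ _ → c ; tokens₂ = λ _ → 0 ; total = λ _ → +-identityʳ c }

-- Degrees, matchings and augmentation in a graph of maximum degree 2.

module Matchings (G : Graph) where
  open Graph G
  open Loads G

  inc : Fin #E → Fin #V → ℕ
  inc e v = [ end₁ e ≐ v ] + [ end₂ e ≐ v ]

  deg : (Fin #E → Bool) → Fin #V → ℕ
  deg S = load (ι ∘ S) (ι ∘ S)

  size : (Fin #E → Bool) → ℕ
  size S = sum (ι ∘ S)

  Incident : Fin #E → Fin #V → Set
  Incident e v = end₁ e ≡ v ⊎ end₂ e ≡ v

  degree≡deg : ∀ S v → degree G S v ≡ deg (lookup S) v
  degree≡deg S v = sum-cong-≗ pointwise
    where
    pointwise : ∀ e → (if lookup S e then inc e v else 0) ≡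
      [ end₁ e ≐ v ] * ι (lookup S e) + [ end₂ e ≐ v ] * ι (lookup S e)
    pointwise e with lookup S e
    ... | true  = sym (cong₂ _+_ (*-identityʳ [ end₁ e ≐ v ]) (*-identityʳ [ end₂ e ≐ v ]))
    ... | false = sym (cong₂ _+_ (*-zeroʳ [ end₁ e ≐ v ]) (*-zeroʳ [ end₂ e ≐ v ]))

  ∑-*-deg : ∀ x S → sum (λ v → x v * deg S v) ≡ sum (λ e → (x (end₁ e) + x (end₂ e)) * ι (S e))
  ∑-*-deg x S = trans (∑-*-load x (ι ∘ S) (ι ∘ S))
    (sum-cong-≗ λ e → sym (*-distribʳ-+ (ι (S e)) (x (end₁ e)) _))

  deg-inc : ∀ S v → deg S v ≡ sum (λ e → inc e v * ι (S e))
  deg-inc S v = sum-cong-≗ λ e → sym (*-distribʳ-+ (ι (S e)) [ end₁ e ≐ v ] _)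

  incident⇒1≤inc : ∀ {e v} → Incident e v → 1 ≤ inc e v
  incident⇒1≤inc {e} {v} (inj₁ refl) rewrite ≐-refl v = s≤s z≤n
  incident⇒1≤inc {e} {v} (inj₂ refl) rewrite ≐-refl v = m≤n+m 1 _

  1≤inc⇒incident : ∀ {e v} → 1 ≤ inc e v → Incident e v
  1≤inc⇒incident {e} {v} 1≤ with end₁ e ≟ v | end₂ e ≟ v
  ... | yes eq | _      = inj₁ eq
  ... | no _   | yes eq = inj₂ eq
  1≤inc⇒incident () | no _ | no _

  inc≤deg : ∀ S {e v} → S e ≡ true → inc e v ≤ deg S v
  inc≤deg S {e} {v} e∈S = begin
    inc e v                       ≡⟨ *-identityʳ (inc e v) ⟨
    inc e v * 1                   ≡⟨ cong (λ b → inc e v * ι b) e∈S ⟨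
    inc e v * ι (S e)             ≤⟨ term≤sum (λ f → inc f v * ι (S f)) e ⟩
    sum (λ f → inc f v * ι (S f)) ≡⟨ deg-inc S v ⟨
    deg S v                       ∎
    where open ≤-Reasoning

  1≤summand : ∀ (S : Fin #E → Bool) {e v} → S e ≡ true → Incident e v → 1 ≤ inc e v * ι (S e)
  1≤summand S {e} {v} e∈S at rewrite e∈S | *-identityʳ (inc e v) = incident⇒1≤inc {e} at

  incident-edge : ∀ S {v} → 0 < deg S v → ∃[ e ] S e ≡ true × Incident e v
  incident-edge S {v} 0<deg
    with sum-positive (λ e → inc e v * ι (S e)) (subst (0 <_) (deg-inc S v) 0<deg)
  ... | e , 0<term with S e in eq
  ...   | true  = e , eq , 1≤inc⇒incident {e} (subst (0 <_) (*-identityʳ (inc e v)) 0<term)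
  ...   | false = contradiction (subst (0 <_) (*-zeroʳ (inc e v)) 0<term) λ ()

  two-incident : ∀ S {e f v} → e ≢ f → S e ≡ true → S f ≡ true →
    Incident e v → Incident f v → 2 ≤ deg S v
  two-incident S {v = v} e≢f e∈S f∈S e∋v f∋v = subst (2 ≤_) (sym (deg-inc S v))
    (two-terms≤sum (λ e → inc e v * ι (S e)) e≢f (1≤summand S e∈S e∋v) (1≤summand S f∈S f∋v))

  three-incident : ∀ S {e f g v} → e ≢ f → e ≢ g → f ≢ g → S e ≡ true → S f ≡ true → S g ≡ true →
    Incident e v → Incident f v → Incident g v → 3 ≤ deg S v
  three-incident S {v = v} e≢f e≢g f≢g e∈S f∈S g∈S e∋v f∋v g∋v = subst (3 ≤_) (sym (deg-inc S v))
    (three-terms≤sum (λ e → inc e v * ι (S e)) e≢f e≢g f≢g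
      (1≤summand S e∈S e∋v) (1≤summand S f∈S f∋v) (1≤summand S g∈S g∋v))

  _⊆ₑ_ : (S T : Fin #E → Bool) → Set
  S ⊆ₑ T = ∀ {e} → S e ≡ true → T e ≡ true

  IsMatching : (Fin #E → Bool) → Set
  IsMatching M = ∀ v → deg M v ≤ 1

  uncovered⇒∉ : ∀ (M : Fin #E → Bool) {e v} → deg M v ≡ 0 → Incident e v → M e ≡ false
  uncovered⇒∉ M {e} {v} v∉M at with M e in eq
  ... | false = refl
  ... | true  = contradiction
    (≤-trans (incident⇒1≤inc {e} at) (≤-trans (inc≤deg M eq) (≤-reflexive v∉M))) λ ()

  unique-incident : ∀ {M} → IsMatching M → ∀ {e f v} → M e ≡ true → M f ≡ true →
    Incident e v → Incident f v → e ≡ f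
  unique-incident {M} matching {e} {f} {v} e∈M f∈M e∋v f∋v with e ≟ f
  ... | yes e≡f = e≡f
  ... | no e≢f  = contradiction
    (≤-trans (two-incident M e≢f e∈M f∈M e∋v f∋v) (matching v)) λ { (s≤s ()) }

  matching-loopless : ∀ {M} → IsMatching M → ∀ {e} → M e ≡ true → end₁ e ≢ end₂ e
  matching-loopless {M} matching {e} e∈M loop = contradiction
    (≤-trans (≤-reflexive (sym inc≡2)) (≤-trans (inc≤deg M e∈M) (matching (end₁ e)))) λ { (s≤s ()) }
    where
    inc≡2 : inc e (end₁ e) ≡ 2
    inc≡2 rewrite sym loop | ≐-refl (end₁ e) = refl

  deg-add : ∀ {M M′} e → (∀ g → ι (M′ g) ≡ ι (M g) + [ e ≐ g ]) → ∀ v → deg M′ v ≡ deg M v + inc e v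
  deg-add {M} {M′} e M′≡ v = begin
    deg M′ v
      ≡⟨ deg-inc M′ v ⟩
    sum (λ g → inc g v * ι (M′ g))
      ≡⟨ sum-cong-≗ (λ g → trans (cong (inc g v *_) (M′≡ g)) (*-distribˡ-+ (inc g v) _ _)) ⟩
    sum (λ g → inc g v * ι (M g) + inc g v * [ e ≐ g ])
      ≡⟨ ∑-distrib-+ (λ g → inc g v * ι (M g)) (λ g → inc g v * [ e ≐ g ]) ⟩
    sum (λ g → inc g v * ι (M g)) + sum (λ g → inc g v * [ e ≐ g ])
      ≡⟨ cong₂ _+_ (sym (deg-inc M v)) (sum-*≐ (λ g → inc g v) e) ⟩
    deg M v + inc e v ∎
    where open ≡-Reasoning

  size-add : ∀ {M M′} e → (∀ g → ι (M′ g) ≡ ι (M g) + [ e ≐ g ]) → size M′ ≡ suc (size M)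
  size-add {M} {M′} e M′≡ = begin
    size M′                            ≡⟨ sum-cong-≗ M′≡ ⟩
    sum (λ g → ι (M g) + [ e ≐ g ])    ≡⟨ ∑-distrib-+ (ι ∘ M) [ e ≐_] ⟩
    size M + sum [ e ≐_]               ≡⟨ cong (size M +_) (sum-≐ e) ⟩
    size M + 1                         ≡⟨ +-comm (size M) 1 ⟩
    suc (size M)                       ∎
    where open ≡-Reasoning

  insert delete : Fin #E → (Fin #E → Bool) → Fin #E → Bool
  insert e M g = does (e ≟ g) ∨ M g
  delete e M g = not (does (e ≟ g)) ∧ M g

  ι-insert : ∀ e M → M e ≡ false → ∀ g → ι (insert e M g) ≡ ι (M g) + [ e ≐ g ]
  ι-insert e M e∉M g with e ≟ g
  ... | yes refl rewrite e∉M = refl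
  ... | no _     = sym (+-identityʳ _)

  ι-delete : ∀ e M → M e ≡ true → ∀ g → ι (M g) ≡ ι (delete e M g) + [ e ≐ g ]
  ι-delete e M e∈M g with e ≟ g
  ... | yes refl rewrite e∈M = refl
  ... | no _     = sym (+-identityʳ _)

  insert-⊆ : ∀ e {M F} → F e ≡ true → M ⊆ₑ F → insert e M ⊆ₑ F
  insert-⊆ e e∈F M⊆F {g} g∈ with e ≟ g
  ... | yes refl = e∈F
  ... | no _     = M⊆F g∈

  delete-⊆ : ∀ e {M F} → M ⊆ₑ F → delete e M ⊆ₑ F
  delete-⊆ e M⊆F {g} g∈ with e ≟ g
  ... | no _ = M⊆F g∈
  delete-⊆ e M⊆F {g} () | yes _

  joins⇒incidentˡ : ∀ {e u v} → Joins G e u v → Incident e u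
  joins⇒incidentˡ (inj₁ (p , _)) = inj₁ p
  joins⇒incidentˡ (inj₂ (_ , q)) = inj₂ q

  joins⇒incidentʳ : ∀ {e u v} → Joins G e u v → Incident e v
  joins⇒incidentʳ (inj₁ (_ , q)) = inj₂ q
  joins⇒incidentʳ (inj₂ (p , _)) = inj₁ p

  joins-sym : ∀ {e u v} → Joins G e u v → Joins G e v u
  joins-sym (inj₁ p) = inj₂ p
  joins-sym (inj₂ p) = inj₁ p

  joins-other : ∀ {e u x y} → Joins G e u x → Joins G e x y → u ≢ x → y ≡ u
  joins-other (inj₁ (p , q)) (inj₁ (r , s)) u≢x = contradiction (trans (sym p) r) u≢x
  joins-other (inj₁ (p , q)) (inj₂ (r , s)) u≢x = trans (sym r) p
  joins-other (inj₂ (p , q)) (inj₁ (r , s)) u≢x = trans (sym s) q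
  joins-other (inj₂ (p , q)) (inj₂ (r , s)) u≢x = contradiction (trans (sym q) s) u≢x

  joins-loop : ∀ {e u} → Joins G e u u → end₁ e ≡ end₂ e
  joins-loop (inj₁ (p , q)) = trans p (sym q)
  joins-loop (inj₂ (p , q)) = trans p (sym q)

  inc-joins : ∀ {e u v} → Joins G e u v → ∀ w → inc e w ≡ [ u ≐ w ] + [ v ≐ w ]
  inc-joins (inj₁ (refl , refl)) w = refl
  inc-joins {e} (inj₂ (refl , refl)) w = +-comm [ end₁ e ≐ w ] _

  Adjacent : (Fin #E → Bool) → Fin #V → Fin #V → Set
  Adjacent F u v = ∃[ e ] F e ≡ true × Joins G e u v

  adjacent? : ∀ F u v → Dec (Adjacent F u v)
  adjacent? F u v = any? λ e → (F e Bool.≟ true) ×-dec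
    (((end₁ e ≟ u) ×-dec (end₂ e ≟ v)) ⊎-dec ((end₁ e ≟ v) ×-dec (end₂ e ≟ u)))

  module _ (F : Fin #E → Bool) (F≤2 : ∀ v → deg F v ≤ 2) where

    -- Two uncovered vertices on a common path or circuit of F: slide the first one
    -- along the walk, two steps at a time, until they are adjacent.
    augment : ∀ M → M ⊆ₑ F → IsMatching M → ∀ {u v} → u ≢ v → deg M u ≡ 0 → deg M v ≡ 0 →
      Star (Adjacent F) u v →
      ∃[ M′ ] M′ ⊆ₑ F × IsMatching M′ × size M′ ≡ suc (size M)
    augment M M⊆F matching u≢v u∉M v∉M ε = contradiction refl u≢v
    augment M M⊆F matching {u} {v} u≢v u∉M v∉M (_◅_ {j = x} (e , e∈F , u-e-x) walk) with u ≟ x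
    ... | yes refl = augment M M⊆F matching u≢v u∉M v∉M walk
    ... | no u≢x with deg M x in deg-x
    ...   | zero = insert e M , insert-⊆ e e∈F M⊆F , matching′ , size-add e (ι-insert e M e∉M)
      where
      e∉M : M e ≡ false
      e∉M = uncovered⇒∉ M u∉M (joins⇒incidentˡ u-e-x)
      matching′ : IsMatching (insert e M)
      matching′ w rewrite deg-add e (ι-insert e M e∉M) w | inc-joins u-e-x w with u ≟ w | x ≟ w
      ... | yes refl | yes refl = contradiction refl u≢x
      ... | yes refl | no _     rewrite u∉M = ≤-refl
      ... | no _     | yes refl rewrite deg-x = ≤-refl
      ... | no _     | no _     = ≤-trans (≤-reflexive (+-identityʳ _)) (matching w)
    ...   | suc _ with walk
    ...     | ε = contradiction (trans (sym deg-x) v∉M) λ ()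
    ...     | _◅_ {j = y} (g , g∈F , x-g-y) walk′ with e ≟ g
    -- The walk turns back along `e`, so its first two steps cancel.
    ...       | yes refl with refl ← joins-other u-e-x x-g-y u≢x =
      augment M M⊆F matching u≢v u∉M v∉M walk′
    ...       | no e≢g =
      let M″ , M″⊆F , matching″ , size≡ = augment M′ M′⊆F matching′ y≢v y∉M′ v∉M′ walk′
      in M″ , M″⊆F , matching″ , trans size≡ (cong suc size-M′)
      where
      e∉M : M e ≡ false
      e∉M = uncovered⇒∉ M u∉M (joins⇒incidentˡ u-e-x)

      -- `x` is covered, but not by `e`, whose end `u` is uncovered. As `x` has degree at most 2 in
      -- `F`, the covering edge must be `g`.
      g∈M : M g ≡ true
      g∈M with incident-edge M (subst (0 <_) (sym deg-x) (s≤s z≤n))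
      ... | f , f∈M , f∋x with f ≟ g
      ...   | yes refl = f∈M
      ...   | no f≢g = contradiction
        (≤-trans (three-incident F (λ { refl → true≢false f∈M e∉M }) e≢g f≢g e∈F (M⊆F f∈M) g∈F
          (joins⇒incidentʳ u-e-x) f∋x (joins⇒incidentˡ x-g-y)) (F≤2 x))
        λ { (s≤s (s≤s ())) }

      -- Exchanging `g` for `e` covers `u` and uncovers `y`, so the gap has slid from `u` to `y`,
      -- two steps nearer to `v` on the walk.
      D M′ : Fin #E → Bool
      D  = delete g M
      M′ = insert e D

      e∉D : D e ≡ false
      e∉D with g ≟ e
      ... | yes _ = refl
      ... | no _  = e∉M

      M′⊆F : M′ ⊆ₑ F
      M′⊆F = insert-⊆ e e∈F (delete-⊆ g {M} M⊆F)

      deg-M′ : ∀ w → deg M′ w + inc g w ≡ deg M w + inc e w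
      deg-M′ w = begin
        deg M′ w + inc g w           ≡⟨ cong (_+ inc g w) (deg-add e (ι-insert e D e∉D) w) ⟩
        deg D w + inc e w + inc g w  ≡⟨ swap (deg D w) (inc e w) (inc g w) ⟩
        deg D w + inc g w + inc e w  ≡⟨ cong (_+ inc e w) (deg-add g (ι-delete g M g∈M) w) ⟨
        deg M w + inc e w            ∎
        where
        open ≡-Reasoning
        swap : ∀ a b d → a + b + d ≡ a + d + b
        swap = solve-∀

      size-M′ : size M′ ≡ size M
      size-M′ = trans (size-add e (ι-insert e D e∉D)) (sym (size-add g (ι-delete g M g∈M)))

      covered : ∀ {w} → Incident g w → deg M w ≢ 0
      covered g∋w w∉M = true≢false g∈M (uncovered⇒∉ M w∉M g∋w)

      y≢u : y ≢ u
      y≢u refl = covered (joins⇒incidentʳ x-g-y) u∉M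
      y≢v : y ≢ v
      y≢v refl = covered (joins⇒incidentʳ x-g-y) v∉M
      x≢v : x ≢ v
      x≢v refl = covered (joins⇒incidentˡ x-g-y) v∉M
      x≢y : x ≢ y
      x≢y x≡y = matching-loopless {M} matching g∈M
        (joins-loop (subst (Joins G g x) (sym x≡y) x-g-y))

      inc-e≡0 : ∀ {w} → u ≢ w → x ≢ w → inc e w ≡ 0
      inc-e≡0 {w} u≢w x≢w = trans (inc-joins u-e-x w) (cong₂ _+_ (≐-≢ u≢w) (≐-≢ x≢w))

      deg-M′≤ : ∀ w → deg M′ w + inc g w ≤ 1 + inc g w
      deg-M′≤ w = ≤-trans (≤-reflexive (deg-M′ w)) (bound (u ≟ w) (x ≟ w))
        where
        bound : Dec (u ≡ w) → Dec (x ≡ w) → deg M w + inc e w ≤ 1 + inc g w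
        bound (yes refl) _ rewrite u∉M | inc-joins u-e-x w | ≐-refl w | ≐-≢ (u≢x ∘ sym) = s≤s z≤n
        bound (no u≢w) (yes refl) rewrite inc-joins u-e-x w | ≐-refl w | ≐-≢ u≢w =
          +-mono-≤ (matching w) (incident⇒1≤inc {g} (joins⇒incidentˡ x-g-y))
        bound (no u≢w) (no x≢w) rewrite inc-e≡0 u≢w x≢w =
          ≤-trans (≤-reflexive (+-identityʳ _)) (≤-trans (matching w) (m≤m+n 1 _))

      matching′ : IsMatching M′
      matching′ w = +-cancelʳ-≤ (inc g w) _ _ (deg-M′≤ w)

      y∉M′ : deg M′ y ≡ 0
      y∉M′ = n≤0⇒n≡0 (+-cancelʳ-≤ 1 _ _
        (≤-trans (+-monoʳ-≤ (deg M′ y) (incident⇒1≤inc {g} (joins⇒incidentʳ x-g-y)))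
        (≤-trans (≤-reflexive (trans (deg-M′ y)
          (trans (cong (deg M y +_) (inc-e≡0 (y≢u ∘ sym) x≢y)) (+-identityʳ _)))) (matching y))))

      v∉M′ : deg M′ v ≡ 0
      v∉M′ = m+n≡0⇒m≡0 (deg M′ v) (trans (deg-M′ v)
        (trans (cong₂ _+_ v∉M (inc-e≡0 u≢v x≢v)) refl))

    size≤#E : ∀ S → size S ≤ #E
    size≤#E S = ≤-trans (sum-mono ι≤1) (≤-reflexive (trans (sum-const #E 1) (*-identityʳ #E)))
      where
      ι≤1 : ∀ e → ι (S e) ≤ 1
      ι≤1 e with S e
      ... | true  = ≤-refl
      ... | false = z≤n

    Separating : (Fin #E → Bool) → Set
    Separating M = ∀ {u v} → deg M u ≡ 0 → deg M v ≡ 0 → Star (Adjacent F) u v → u ≡ v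

    -- Each augmentation adds an edge, and a matching has at most `#E` of them, which is the fuel of
    -- `search`.
    separating-matching : ∀ M → M ⊆ₑ F → IsMatching M →
      ∃[ M′ ] M′ ⊆ₑ F × IsMatching M′ × size M ≤ size M′ × Separating M′
    separating-matching M M⊆F matching = search #E M M⊆F matching (m≤m+n #E _)
      where
      search : ∀ k M → M ⊆ₑ F → IsMatching M → #E ≤ k + size M →
        ∃[ M′ ] M′ ⊆ₑ F × IsMatching M′ × size M ≤ size M′ × Separating M′
      search k M M⊆F matching #E≤ with any? (λ u → any? λ v →
        (¬? (u ≟ v) ×-dec ((deg M u ℕ.≟ 0) ×-dec (deg M v ℕ.≟ 0)))
          ×-dec star? (adjacent? F) u v)
      ... | no none = M , M⊆F , matching , ≤-refl , separating
        where
        separating : Separating M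
        separating {u} {v} u∉M v∉M walk with u ≟ v
        ... | yes u≡v = u≡v
        ... | no u≢v  = contradiction (u , v , (u≢v , u∉M , v∉M) , walk) none
      ... | yes (u , v , (u≢v , u∉M , v∉M) , walk)
        with augment M M⊆F matching u≢v u∉M v∉M walk
      ...   | M′ , M′⊆F , matching′ , size≡ with k
      ...     | zero = contradiction
        (≤-trans (s≤s #E≤) (≤-trans (≤-reflexive (sym size≡)) (size≤#E M′))) (<-irrefl refl)
      ...     | suc k =
        let M″ , M″⊆F , matching″ , size≤ , separating = search k M′ M′⊆F matching′
              (≤-trans #E≤ (≤-reflexive (trans (sym (+-suc k _)) (cong (k +_) (sym size≡)))))
        in M″ , M″⊆F , matching″ , ≤-trans (n≤1+n _) (≤-trans (≤-reflexive (sym size≡)) size≤) , separating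

-- Splitting on the first argument lets `is true ∘ c` and `is false ∘ c` compute to `c` and
-- `not ∘ c`, so statements for a variable colour specialise without rewriting.
is : Bool → Bool → Bool
is true  b = b
is false b = not b

-- Arithmetic of the cut inequalities.

module _ (m p d₁ d₂ dF : ℕ) where

  -- Three times the bound along `M₁` plus twice the bound along `M`. The weights are forced by the
  -- target: `M₁` then costs exactly 3d₁, and 2d₂ + 2z fits into 3dF, where `d₁`, `d₂`, `dF` are the
  -- numbers of cut edges in `M₁`, `M` and the 2-factor.
  cut-bound : ∀ z → m ≤ p + d₁ → m ≤ p + d₂ + z → d₂ ≤ dF → 2 * z ≤ dF →
    5 * m ≤ 5 * p + 3 * (d₁ + dF)
  cut-bound z m≤₁ m≤₂ d₂≤ 2z≤ = begin
    5 * m                                         ≡⟨ split m ⟩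
    3 * m + 2 * m                                 ≤⟨ +-mono-≤ (*-monoʳ-≤ 3 m≤₁) (*-monoʳ-≤ 2 m≤₂) ⟩
    3 * (p + d₁) + 2 * (p + d₂ + z)               ≡⟨ regroup p d₁ d₂ z ⟩
    5 * p + 3 * d₁ + 2 * d₂ + 2 * z               ≤⟨ +-mono-≤ (+-monoʳ-≤ (5 * p + 3 * d₁) (*-monoʳ-≤ 2 d₂≤)) 2z≤ ⟩
    5 * p + 3 * d₁ + 2 * dF + dF                  ≡⟨ join p d₁ dF ⟩
    5 * p + 3 * (d₁ + dF)                         ∎
    where
    open ≤-Reasoning
    split : ∀ m → 5 * m ≡ 3 * m + 2 * m
    split = solve-∀
    regroup : ∀ p a b z → 3 * (p + a) + 2 * (p + b + z) ≡ 5 * p + 3 * a + 2 * b + 2 * z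
    regroup = solve-∀
    join : ∀ p a f → 5 * p + 3 * a + 2 * f + f ≡ 5 * p + 3 * (a + f)
    join = solve-∀

  -- In the last step 4 · 3i ≤ 4q + 3 forces 3i ≤ q.
  large-cut-bound : ∀ n i → m ≤ p + d₁ → m ≤ p + d₂ + n → d₂ ≤ dF →
    5 * n ≤ 3 + (d₁ + dF) → 2 * i + (d₁ + dF) ≡ 3 * (p + m) → 3 * i ≤ 7 * p + 2 * m
  large-cut-bound n i m≤₁ m≤₂ d₂≤ 5n≤ edges = ≤-pred (*-cancelˡ-< 4 (3 * i) _
    (≤-trans (s≤s (+-cancelʳ-≤ (10 * m + 6 * (d₁ + dF)) _ (4 * (7 * p + 2 * m) + 3) bound))
      (≤-reflexive (rounding (7 * p + 2 * m)))))
    where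
    open ≤-Reasoning
    rounding : ∀ q → suc (4 * q + 3) ≡ 4 * suc q
    rounding = solve-∀
    e₁ : ∀ i d m → 4 * (3 * i) + (10 * m + 6 * d) ≡ 6 * (2 * i + d) + 5 * (m + m)
    e₁ = solve-∀
    e₂ : ∀ p d₁ n d₂ → 5 * (p + d₁ + (p + d₂ + n)) ≡ 10 * p + 5 * (d₁ + d₂) + 5 * n
    e₂ = solve-∀
    e₃ : ∀ p m d → 6 * (3 * (p + m)) + (10 * p + 5 * d + (3 + d)) ≡
      4 * (7 * p + 2 * m) + 3 + (10 * m + 6 * d)
    e₃ = solve-∀
    -- Six copies of the edge count and five of the sum of the two colour bounds; the common summand
    -- 10m + 6d stands in for subtraction.
    bound : 4 * (3 * i) + (10 * m + 6 * (d₁ + dF)) ≤ 4 * (7 * p + 2 * m) + 3 + (10 * m + 6 * (d₁ + dF))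
    bound = begin
      4 * (3 * i) + (10 * m + 6 * (d₁ + dF))
        ≡⟨ e₁ i (d₁ + dF) m ⟩
      6 * (2 * i + (d₁ + dF)) + 5 * (m + m)
        ≤⟨ +-mono-≤ (≤-reflexive (cong (6 *_) edges)) (*-monoʳ-≤ 5 (+-mono-≤ m≤₁ m≤₂)) ⟩
      6 * (3 * (p + m)) + 5 * (p + d₁ + (p + d₂ + n))
        ≡⟨ cong (6 * (3 * (p + m)) +_) (e₂ p d₁ n d₂) ⟩
      6 * (3 * (p + m)) + (10 * p + 5 * (d₁ + d₂) + 5 * n)
        ≤⟨ +-monoʳ-≤ (6 * (3 * (p + m))) (+-mono-≤ (+-monoʳ-≤ (10 * p) (*-monoʳ-≤ 5 (+-monoʳ-≤ d₁ d₂≤))) 5n≤) ⟩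
      6 * (3 * (p + m)) + (10 * p + 5 * (d₁ + dF) + (3 + (d₁ + dF)))
        ≡⟨ e₃ p m (d₁ + dF) ⟩
      4 * (7 * p + 2 * m) + 3 + (10 * m + 6 * (d₁ + dF)) ∎

valuation⇒inside : ∀ m p d i → 5 * m ≤ 5 * p + 3 * d → 2 * i + d ≡ 3 * (p + m) →
  3 * i ≤ 7 * p + 2 * m
valuation⇒inside m p d i 5m≤ edges =
  *-cancelˡ-≤ 2 (+-cancelʳ-≤ (5 * m + 3 * d) (2 * (3 * i)) _ (begin
    2 * (3 * i) + (5 * m + 3 * d)            ≡⟨ e₁ i d m ⟩
    3 * (2 * i + d) + 5 * m                  ≤⟨ +-mono-≤ (≤-reflexive (cong (3 *_) edges)) 5m≤ ⟩
    3 * (3 * (p + m)) + (5 * p + 3 * d)      ≡⟨ e₂ p m d ⟩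
    2 * (7 * p + 2 * m) + (5 * m + 3 * d)    ∎))
  where
  open ≤-Reasoning
  e₁ : ∀ i d m → 2 * (3 * i) + (5 * m + 3 * d) ≡ 3 * (2 * i + d) + 5 * m
  e₁ = solve-∀
  e₂ : ∀ p m d → 3 * (3 * (p + m)) + (5 * p + 3 * d) ≡ 2 * (7 * p + 2 * m) + (5 * m + 3 * d)
  e₂ = solve-∀

-- Edge cuts against colourings and against 2-factors.

module Cuts (G : Graph) where
  open Graph G
  open Loads G
  open Matchings G

  #_ : (Fin #V → Bool) → ℕ
  # X = sum (ι ∘ X)

  crosses : (Fin #V → Bool) → Fin #E → Bool
  crosses X e = X (end₁ e) xor X (end₂ e)

  cut : (Fin #E → Bool) → (Fin #V → Bool) → ℕ
  cut S X = sum λ e → ι (S e ∧ crosses X e)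

  _∩ᵥ_ : (X Y : Fin #V → Bool) → Fin #V → Bool
  (X ∩ᵥ Y) v = X v ∧ Y v

  #-⊆ : ∀ {X Y : Fin #V → Bool} → (∀ {v} → X v ≡ true → Y v ≡ true) → # X ≤ # Y
  #-⊆ {X} {Y} X⊆Y = sum-mono pointwise
    where
    pointwise : ∀ v → ι (X v) ≤ ι (Y v)
    pointwise v with X v in eq
    ... | false = z≤n
    ... | true rewrite X⊆Y {v} eq = ≤-refl

  deg-+ : ∀ {S T U : Fin #E → Bool} → (∀ e → ι (S e) + ι (T e) ≡ ι (U e)) →
    ∀ v → deg S v + deg T v ≡ deg U v
  deg-+ {S} {T} {U} S+T≡U v = begin
    deg S v + deg T v
      ≡⟨ cong₂ _+_ (deg-inc S v) (deg-inc T v) ⟩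
    sum (λ e → inc e v * ι (S e)) + sum (λ e → inc e v * ι (T e))
      ≡⟨ ∑-distrib-+ (λ e → inc e v * ι (S e)) (λ e → inc e v * ι (T e)) ⟨
    sum (λ e → inc e v * ι (S e) + inc e v * ι (T e))
      ≡⟨ sum-cong-≗ (λ e → trans (sym (*-distribˡ-+ (inc e v) _ _)) (cong (inc e v *_) (S+T≡U e))) ⟩
    sum (λ e → inc e v * ι (U e))
      ≡⟨ deg-inc U v ⟨
    deg U v ∎
    where open ≡-Reasoning

  cut-+ : ∀ {S T U : Fin #E → Bool} → (∀ e → ι (S e) + ι (T e) ≡ ι (U e)) →
    ∀ X → cut S X + cut T X ≡ cut U X
  cut-+ {S} {T} {U} S+T≡U X = trans
    (sym (∑-distrib-+ (λ e → ι (S e ∧ crosses X e)) (λ e → ι (T e ∧ crosses X e))))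
    (sum-cong-≗ pointwise)
    where
    ι-∧ : ∀ a b → ι (a ∧ b) ≡ ι a * ι b
    ι-∧ true  b = sym (+-identityʳ (ι b))
    ι-∧ false b = refl
    pointwise : ∀ e → ι (S e ∧ crosses X e) + ι (T e ∧ crosses X e) ≡ ι (U e ∧ crosses X e)
    pointwise e rewrite ι-∧ (S e) (crosses X e) | ι-∧ (T e) (crosses X e) | ι-∧ (U e) (crosses X e) =
      trans (sym (*-distribʳ-+ (ι (crosses X e)) (ι (S e)) (ι (T e)))) (cong (_* ι (crosses X e)) (S+T≡U e))

  cut-⊆ : ∀ {S T} → S ⊆ₑ T → ∀ X → cut S X ≤ cut T X
  cut-⊆ {S} {T} S⊆T X = sum-mono pointwise
    where
    pointwise : ∀ e → ι (S e ∧ crosses X e) ≤ ι (T e ∧ crosses X e)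
    pointwise e with S e in eq
    ... | false = z≤n
    ... | true rewrite S⊆T {e} eq = ≤-refl

  cut-complement : ∀ S X → cut S (not ∘ X) ≡ cut S X
  cut-complement S X = sum-cong-≗ λ e → cong (λ b → ι (S e ∧ b)) (xor-not (X (end₁ e)) (X (end₂ e)))
    where
    xor-not : ∀ a b → not a xor not b ≡ a xor b
    xor-not true  b = refl
    xor-not false b = Bool.not-involutive b

  cut-all : ∀ S → cut S (λ _ → true) ≡ 0
  cut-all S = trans (sum-cong-≗ λ e → cong ι (Bool.∧-zeroʳ (S e))) (sum-replicate-zero #E)

  -- Handshaking over `X`: an edge of `S` inside `X` is seen from both ends, a cut edge from one.
  -- For r = 3 this trades cut edges for inside edges; for r = 2 it makes every cut of a 2-factor
  -- even.
  regular-inside+cut : ∀ S r → (∀ v → deg S v ≡ r) → ∀ X →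
    2 * sum (λ e → ι (S e ∧ (X (end₁ e) ∧ X (end₂ e)))) + cut S X ≡ r * # X
  regular-inside+cut S r regular X = begin
    2 * sum in-edge + cut S X
      ≡⟨ cong (_+ cut S X) (*-distribˡ-sum 2 in-edge) ⟩
    sum (λ e → 2 * in-edge e) + cut S X
      ≡⟨ ∑-distrib-+ (λ e → 2 * in-edge e) (λ e → ι (S e ∧ crosses X e)) ⟨
    sum (λ e → 2 * in-edge e + ι (S e ∧ crosses X e))
      ≡⟨ sum-cong-≗ (λ e → sym (pointwise (S e) (X (end₁ e)) (X (end₂ e)))) ⟩
    sum (λ e → (ι (X (end₁ e)) + ι (X (end₂ e))) * ι (S e))
      ≡⟨ ∑-*-deg (ι ∘ X) S ⟨
    sum (λ v → ι (X v) * deg S v)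
      ≡⟨ sum-cong-≗ (λ v → trans (cong (ι (X v) *_) (regular v)) (*-comm (ι (X v)) r)) ⟩
    sum (λ v → r * ι (X v))
      ≡⟨ *-distribˡ-sum r (ι ∘ X) ⟨
    r * # X ∎
    where
    open ≡-Reasoning
    in-edge : Fin #E → ℕ
    in-edge e = ι (S e ∧ (X (end₁ e) ∧ X (end₂ e)))
    pointwise : ∀ s a b → (ι a + ι b) * ι s ≡ 2 * ι (s ∧ (a ∧ b)) + ι (s ∧ (a xor b))
    pointwise true true true = refl
    pointwise true true false = refl
    pointwise true false true = refl
    pointwise true false false = refl
    pointwise false a b = *-zeroʳ (ι a + ι b)

  module Coloured (c : Fin #V → Bool) where

    colour : Bool → Fin #V → Bool
    colour k v = is k (c v)

    Bichromatic : (Fin #E → Bool) → Set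
    Bichromatic S = ∀ {e} → S e ≡ true → c (end₂ e) ≡ not (c (end₁ e))

    -- The edges of S inside X contribute equally to both colours.
    colour-excess : ∀ {S} {Z : Fin #V → Bool} → Bichromatic S → (∀ v → deg S v + ι (Z v) ≡ 1) → ∀ k X →
      # (X ∩ᵥ colour (not k)) + # ((X ∩ᵥ Z) ∩ᵥ colour k) ≤
      # (X ∩ᵥ colour k) + cut S X + # ((X ∩ᵥ Z) ∩ᵥ colour (not k))
    colour-excess {S} {Z} bichromatic deg+Z≡1 k X = begin
      # N + # ((X ∩ᵥ Z) ∩ᵥ colour k)
        ≡⟨ cong (_+ # ((X ∩ᵥ Z) ∩ᵥ colour k)) (count (not k)) ⟩
      sum (edges N) + # ((X ∩ᵥ Z) ∩ᵥ colour (not k)) + # ((X ∩ᵥ Z) ∩ᵥ colour k)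
        ≤⟨ +-monoˡ-≤ _ (+-monoˡ-≤ _ (sum-mono pointwise)) ⟩
      sum (λ e → edges P e + ι (S e ∧ crosses X e)) + # ((X ∩ᵥ Z) ∩ᵥ colour (not k)) + # ((X ∩ᵥ Z) ∩ᵥ colour k)
        ≡⟨ cong (λ s → s + # ((X ∩ᵥ Z) ∩ᵥ colour (not k)) + # ((X ∩ᵥ Z) ∩ᵥ colour k))
             (∑-distrib-+ (edges P) (λ e → ι (S e ∧ crosses X e))) ⟩
      sum (edges P) + cut S X + # ((X ∩ᵥ Z) ∩ᵥ colour (not k)) + # ((X ∩ᵥ Z) ∩ᵥ colour k)
        ≡⟨ swap (sum (edges P)) (cut S X) (# ((X ∩ᵥ Z) ∩ᵥ colour (not k))) (# ((X ∩ᵥ Z) ∩ᵥ colour k)) ⟩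
      sum (edges P) + # ((X ∩ᵥ Z) ∩ᵥ colour k) + cut S X + # ((X ∩ᵥ Z) ∩ᵥ colour (not k))
        ≡⟨ cong (λ s → s + cut S X + # ((X ∩ᵥ Z) ∩ᵥ colour (not k))) (count k) ⟨
      # P + cut S X + # ((X ∩ᵥ Z) ∩ᵥ colour (not k)) ∎
      where
      open ≤-Reasoning
      N P : Fin #V → Bool
      N = X ∩ᵥ colour (not k)
      P = X ∩ᵥ colour k
      edges : (Fin #V → Bool) → Fin #E → ℕ
      edges Y e = (ι (Y (end₁ e)) + ι (Y (end₂ e))) * ι (S e)
      swap : ∀ a b d f → a + b + d + f ≡ a + f + b + d
      swap = solve-∀

      count : ∀ k → # (X ∩ᵥ colour k) ≡ sum (edges (X ∩ᵥ colour k)) + # ((X ∩ᵥ Z) ∩ᵥ colour k)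
      count k = begin-equality
        # Y
          ≡⟨ sum-cong-≗ (λ v → sym (trans (cong (ι (Y v) *_) (deg+Z≡1 v)) (*-identityʳ (ι (Y v))))) ⟩
        sum (λ v → ι (Y v) * (deg S v + ι (Z v)))
          ≡⟨ sum-cong-≗ (λ v → trans (*-distribˡ-+ (ι (Y v)) (deg S v) _)
               (cong (ι (Y v) * deg S v +_) (∧-swap (X v) (colour k v) (Z v)))) ⟩
        sum (λ v → ι (Y v) * deg S v + ι (((X ∩ᵥ Z) ∩ᵥ colour k) v))
          ≡⟨ ∑-distrib-+ (λ v → ι (Y v) * deg S v) (ι ∘ ((X ∩ᵥ Z) ∩ᵥ colour k)) ⟩
        sum (λ v → ι (Y v) * deg S v) + # ((X ∩ᵥ Z) ∩ᵥ colour k)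
          ≡⟨ cong (_+ # ((X ∩ᵥ Z) ∩ᵥ colour k)) (∑-*-deg (ι ∘ Y) S) ⟩
        sum (edges Y) + # ((X ∩ᵥ Z) ∩ᵥ colour k) ∎
        where
        Y : Fin #V → Bool
        Y = X ∩ᵥ colour k
        ∧-swap : ∀ x y z → ι (x ∧ y) * ι z ≡ ι ((x ∧ z) ∧ y)
        ∧-swap true true true = refl
        ∧-swap true true false = refl
        ∧-swap true false true = refl
        ∧-swap true false false = refl
        ∧-swap false y z = refl

      pointwise : ∀ e → edges N e ≤ edges P e + ι (S e ∧ crosses X e)
      pointwise e with S e in eq
      ... | false = ≤-trans (≤-reflexive (*-zeroʳ (ι (N (end₁ e)) + ι (N (end₂ e))))) z≤n
      ... | true rewrite bichromatic eq = bound k (c (end₁ e)) (X (end₁ e)) (X (end₂ e))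
        where
        bound : ∀ k c a b → (ι (a ∧ is (not k) c) + ι (b ∧ is (not k) (not c))) * 1 ≤
          (ι (a ∧ is k c) + ι (b ∧ is k (not c))) * 1 + ι (a xor b)
        bound true  true  true  true  = s≤s z≤n
        bound true  true  true  false = z≤n
        bound true  true  false true  = s≤s z≤n
        bound true  true  false false = z≤n
        bound true  false true  true  = s≤s z≤n
        bound true  false true  false = s≤s z≤n
        bound true  false false true  = z≤n
        bound true  false false false = z≤n
        bound false true  true  true  = s≤s z≤n
        bound false true  true  false = s≤s z≤n
        bound false true  false true  = z≤n
        bound false true  false false = z≤n
        bound false false true  true  = s≤s z≤n
        bound false false true  false = z≤n
        bound false false false true  = s≤s z≤n
        bound false false false false = z≤n

  module _ (F : Fin #E → Bool) where

    reach? : ∀ u v → Dec (Star (Adjacent F) u v)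
    reach? = star? (adjacent? F)

    reach : Fin #V → Fin #V → Bool
    reach u v = does (reach? u v)

    reach-ends : ∀ u {e} → F e ≡ true → reach u (end₁ e) ≡ reach u (end₂ e)
    reach-ends u {e} e∈F with reach? u (end₁ e) | reach? u (end₂ e)
    ... | yes _ | yes _ = refl
    ... | no _  | no _  = refl
    ... | yes w | no ¬w = contradiction (w ◅◅ ((e , e∈F , inj₁ (refl , refl)) ◅ ε)) ¬w
    ... | no ¬w | yes w = contradiction (w ◅◅ ((e , e∈F , inj₂ (refl , refl)) ◅ ε)) ¬w

    Escapes : (Fin #V → Bool) → Fin #V → Set
    Escapes X u = ∃[ v ] X v ≡ false × Star (Adjacent F) u v

    module _ (2-regular : ∀ v → deg F v ≡ 2) where

      -- Let `Y` be the part in `X` of the circuit through `u`. The escaping walk leaves `Y` along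
      -- an edge of `F`, so the cut of `Y` in `F` is nonempty, and it is even. An edge of `F` has
      -- both ends on the circuit or neither, so each edge counted leaves `X` too.
      circuit-cut : ∀ X u → X u ≡ true → Escapes X u →
        2 ≤ sum (λ e → ι (reach u (end₁ e)) * ι (F e ∧ crosses X e))
      circuit-cut X u u∈X (v , v∉X , walk) = ≤-trans
        (even-positive (# Y) (sum λ e → ι (F e ∧ (Y (end₁ e) ∧ Y (end₂ e)))) (cut F Y)
          (regular-inside+cut F 2 2-regular Y) 0<cut)
        (sum-mono pointwise)
        where
        Y : Fin #V → Bool
        Y = reach u ∩ᵥ X

        even-positive : ∀ a b d → 2 * b + d ≡ 2 * a → 0 < d → 2 ≤ d
        even-positive a b (suc zero)    eq _ = contradiction (trans (sym eq) (+-comm (2 * b) 1)) (even≢odd a b)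
        even-positive a b (suc (suc d)) eq _ = s≤s (s≤s z≤n)

        0<cut : 0 < cut F Y
        0<cut with crossing Y walk u∈Y v∉Y
          where
          u∈Y : Y u ≡ true
          u∈Y = cong₂ _∧_ (dec-true (reach? u u) ε) u∈X
          v∉Y : Y v ≡ false
          v∉Y = trans (cong (reach u v ∧_) v∉X) (Bool.∧-zeroʳ _)
        ... | x , y , (e , e∈F , joins) , x∈Y , y∉Y =
          ≤-trans (≤-reflexive (sym (cong ι (cong₂ _∧_ e∈F (e-crosses joins)))))
            (term≤sum (λ e → ι (F e ∧ crosses Y e)) e)
          where
          e-crosses : Joins G e x y → crosses Y e ≡ true
          e-crosses (inj₁ (refl , refl)) = cong₂ _xor_ x∈Y y∉Y
          e-crosses (inj₂ (refl , refl)) = cong₂ _xor_ y∉Y x∈Y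

        pointwise : ∀ e → ι (F e ∧ crosses Y e) ≤ ι (reach u (end₁ e)) * ι (F e ∧ crosses X e)
        pointwise e with F e in eq
        ... | false = z≤n
        ... | true rewrite reach-ends u {e} eq with reach u (end₂ e)
        ...   | true  = ≤-reflexive (sym (+-identityʳ _))
        ...   | false = z≤n

      -- Distinct vertices of Z lie on distinct circuits of F, and each of these
      -- circuits uses at least two edges of the cut.
      escaping-cut : ∀ {Z : Fin #V → Bool} →
        (∀ {u v} → Z u ≡ true → Z v ≡ true → Star (Adjacent F) u v → u ≡ v) →
        ∀ X → (∀ u → X u ≡ true → Z u ≡ true → Escapes X u) → 2 * # (X ∩ᵥ Z) ≤ cut F X
      escaping-cut {Z} separated X escapes = begin
        2 * # W
          ≡⟨ *-distribˡ-sum 2 (ι ∘ W) ⟩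
        sum (λ u → 2 * ι (W u))
          ≤⟨ sum-mono circuit ⟩
        sum (λ u → ι (W u) * sum (λ e → ι (reach u (end₁ e)) * x e))
          ≡⟨ sum-cong-≗ (λ u → *-distribˡ-sum (ι (W u)) (λ e → ι (reach u (end₁ e)) * x e)) ⟩
        sum (λ u → sum (λ e → ι (W u) * (ι (reach u (end₁ e)) * x e)))
          ≡⟨ ∑-comm (λ u e → ι (W u) * (ι (reach u (end₁ e)) * x e)) ⟩
        sum (λ e → sum (λ u → ι (W u) * (ι (reach u (end₁ e)) * x e)))
          ≤⟨ sum-mono collect ⟩
        cut F X ∎
        where
        open ≤-Reasoning
        W : Fin #V → Bool
        W = X ∩ᵥ Z
        x : Fin #E → ℕ
        x e = ι (F e ∧ crosses X e)

        circuit : ∀ u → 2 * ι (W u) ≤ ι (W u) * sum (λ e → ι (reach u (end₁ e)) * x e)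
        circuit u with X u in u∈X | Z u in u∈Z
        ... | true  | true  =
          ≤-trans (circuit-cut X u u∈X (escapes u u∈X u∈Z)) (≤-reflexive (sym (+-identityʳ _)))
        ... | true  | false = z≤n
        ... | false | _     = z≤n

        collect : ∀ e → sum (λ u → ι (W u) * (ι (reach u (end₁ e)) * x e)) ≤ x e
        collect e = begin
          sum (λ u → ι (W u) * (ι (reach u (end₁ e)) * x e))
            ≡⟨ sum-cong-≗ (λ u → rearrange (W u) (reach u (end₁ e)) (x e)) ⟩
          sum (λ u → x e * ι (W u ∧ reach u (end₁ e)))
            ≡⟨ *-distribˡ-sum (x e) (λ u → ι (W u ∧ reach u (end₁ e))) ⟨
          x e * sum (λ u → ι (W u ∧ reach u (end₁ e)))
            ≤⟨ *-monoʳ-≤ (x e) (sum-ι-unique (λ u → W u ∧ reach u (end₁ e)) unique) ⟩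
          x e * 1
            ≡⟨ *-identityʳ (x e) ⟩
          x e ∎
          where
          rearrange : ∀ a b n → ι a * (ι b * n) ≡ n * ι (a ∧ b)
          rearrange true  true  n = trans (+-identityʳ _) (trans (+-identityʳ n) (sym (*-identityʳ n)))
          rearrange true  false n = sym (*-zeroʳ n)
          rearrange false b     n = sym (*-zeroʳ n)

          unique : ∀ {u v} → W u ∧ reach u (end₁ e) ≡ true → W v ∧ reach v (end₁ e) ≡ true → u ≡ v
          unique {u} {v} u∈ v∈ with X u | Z u in u∈Z | X v | Z v in v∈Z
          ... | true | true | true | true = separated u∈Z v∈Z
            (does⇒ (reach? u (end₁ e)) u∈ ◅◅ reverse adjacent-sym (does⇒ (reach? v (end₁ e)) v∈))
            where
            adjacent-sym : ∀ {x y} → Adjacent F x y → Adjacent F y x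
            adjacent-sym (f , f∈F , joins) = f , f∈F , joins-sym joins

-- Components, circuits and cyclic edge-connectivity.

∣S∣≡sum : ∀ {n} (S : Subset n) → ∣ S ∣ ≡ sum (ι ∘ lookup S)
∣S∣≡sum []          = refl
∣S∣≡sum (true ∷ S)  = cong suc (∣S∣≡sum S)
∣S∣≡sum (false ∷ S) = ∣S∣≡sum S

∈-tabulate⁺ : ∀ {n} {b : Fin n → Bool} {i} → b i ≡ true → i ∈ tabulate b
∈-tabulate⁺ {b = b} {i} eq = lookup⇒[]= i _ (trans (lookup∘tabulate b i) eq)

∈-tabulate⁻ : ∀ {n} {b : Fin n → Bool} {i} → i ∈ tabulate b → b i ≡ true
∈-tabulate⁻ {b = b} {i} i∈ = trans (sym (lookup∘tabulate b i)) ([]=⇒lookup i∈)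

module Components (G : Graph) where
  open Graph G
  open Loads G
  open Matchings G
  open Cuts G

  connected? : ∀ S u v → Dec (Connected G S u v)
  connected? S = star? λ u v → any? λ e → (e ∈? S) ×-dec
    (((end₁ e ≟ u) ×-dec (end₂ e ≟ v)) ⊎-dec ((end₁ e ≟ v) ×-dec (end₂ e ≟ u)))

  connected-sym : ∀ {S u v} → Connected G S u v → Connected G S v u
  connected-sym = reverse λ (e , e∈S , joins) → e , e∈S , joins-sym joins

  component : EdgeSet G → Fin #V → VertexSet G
  component S u = tabulate λ v → does (connected? S u v)

  ∈-component⁺ : ∀ {S u v} → Connected G S u v → v ∈ component S u
  ∈-component⁺ {S} {u} {v} w = ∈-tabulate⁺ (dec-true (connected? S u v) w)

  ∈-component⁻ : ∀ {S u v} → v ∈ component S u → Connected G S u v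
  ∈-component⁻ {S} {u} {v} v∈ = does⇒ (connected? S u v) (∈-tabulate⁻ v∈)

  component-isComponent : ∀ S u → IsComponent G S (component S u)
  component-isComponent S u =
    (u , ∈-component⁺ ε) ,
    (λ x∈ y∈ → connected-sym (∈-component⁻ x∈) ◅◅ ∈-component⁻ y∈) ,
    (λ x∈ w → ∈-component⁺ (∈-component⁻ x∈ ◅◅ w))

  module _ (F : Fin #E → Bool) (2-regular : ∀ v → deg F v ≡ 2) where

    circuit-edge : Fin #V → Fin #E → Bool
    circuit-edge u e = F e ∧ reach F u (end₁ e)

    circuit : Fin #V → EdgeSet G
    circuit u = tabulate (circuit-edge u)

    reach-incident : ∀ {u e v} → F e ≡ true → Incident e v → reach F u (end₁ e) ≡ reach F u v
    reach-incident e∈F (inj₁ refl) = refl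
    reach-incident {u} e∈F (inj₂ refl) = reach-ends F u e∈F

    -- An edge of `F` at `v` lies on the circuit of `u` exactly when `v` is reachable from `u`, so
    -- `v` keeps both its edges of `F` or neither.
    degree-circuit : ∀ u v → degree G (circuit u) v ≡ ι (reach F u v) * 2
    degree-circuit u v = begin
      degree G (circuit u) v
        ≡⟨ degree≡deg (circuit u) v ⟩
      deg (lookup (circuit u)) v
        ≡⟨ deg-inc (lookup (circuit u)) v ⟩
      sum (λ e → inc e v * ι (lookup (circuit u) e))
        ≡⟨ sum-cong-≗ (λ e → trans
             (cong (λ b → inc e v * ι b) (lookup∘tabulate (circuit-edge u) e)) (pointwise e)) ⟩
      sum (λ e → ι (reach F u v) * (inc e v * ι (F e)))
        ≡⟨ *-distribˡ-sum (ι (reach F u v)) (λ e → inc e v * ι (F e)) ⟨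
      ι (reach F u v) * sum (λ e → inc e v * ι (F e))
        ≡⟨ cong (ι (reach F u v) *_) (trans (sym (deg-inc F v)) (2-regular v)) ⟩
      ι (reach F u v) * 2 ∎
      where
      open ≡-Reasoning
      pointwise : ∀ e → inc e v * ι (circuit-edge u e) ≡ ι (reach F u v) * (inc e v * ι (F e))
      pointwise e with inc e v in inc≡
      ... | zero = sym (*-zeroʳ (ι (reach F u v)))
      ... | suc i with F e in e∈F
      ...   | false rewrite *-zeroʳ (suc i) = sym (*-zeroʳ (ι (reach F u v)))
      ...   | true rewrite *-identityʳ (suc i)
        | reach-incident {u} {e} {v} e∈F (1≤inc⇒incident {e} (subst (1 ≤_) (sym inc≡) (s≤s z≤n)))
        = *-comm (suc i) (ι (reach F u v))

    degree≡2⇒reach : ∀ {u v} → degree G (circuit u) v ≡ 2 → reach F u v ≡ true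
    degree≡2⇒reach {u} {v} eq with reach F u v | degree-circuit u v
    ... | true  | _ = refl
    ... | false | eq′ with () ← trans (sym eq) eq′

    circuit-walk : ∀ {u x y} → reach F u x ≡ true → Star (Adjacent F) x y → Connected G (circuit u) x y
    circuit-walk x∈ ε = ε
    circuit-walk {u} x∈ ((e , e∈F , joins) ◅ w) =
      (e , ∈-tabulate⁺ (cong₂ _∧_ e∈F end₁∈) , joins) ◅ circuit-walk
        (trans (sym (reach-incident e∈F (joins⇒incidentʳ joins))) end₁∈) w
      where
      end₁∈ : reach F u (end₁ e) ≡ true
      end₁∈ = trans (reach-incident e∈F (joins⇒incidentˡ joins)) x∈

    reach-refl : ∀ u → reach F u u ≡ true
    reach-refl u = dec-true (reach? F u u) ε

    from-centre : ∀ {u v} → reach F u v ≡ true → Connected G (circuit u) u v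
    from-centre {u} {v} v∈ = circuit-walk (reach-refl u) (does⇒ (reach? F u v) v∈)

    circuit-isCircuit : ∀ u → IsCircuit G (circuit u)
    circuit-isCircuit u = nonempty , degrees , connected
      where
      nonempty : ∃[ e ] e ∈ circuit u
      nonempty =
        let e , e∈F , e∋u = incident-edge F {u} (subst (0 <_) (sym (2-regular u)) (s≤s z≤n))
        in e , ∈-tabulate⁺ (cong₂ _∧_ e∈F (trans (reach-incident e∈F e∋u) (reach-refl u)))

      degrees : ∀ v → degree G (circuit u) v ≡ 0 ⊎ degree G (circuit u) v ≡ 2
      degrees v with reach F u v | degree-circuit u v
      ... | true  | eq = inj₂ eq
      ... | false | eq = inj₁ eq

      connected : ∀ {x y} → degree G (circuit u) x ≡ 2 → degree G (circuit u) y ≡ 2 → Connected G (circuit u) x y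
      connected x∈ y∈ = connected-sym (from-centre (degree≡2⇒reach x∈)) ◅◅ from-centre (degree≡2⇒reach y∈)

    circuit⁻ : ∀ {u e} → e ∈ circuit u → F e ≡ true × reach F u (end₁ e) ≡ true
    circuit⁻ {u} {e} e∈ with F e | ∈-tabulate⁻ {b = circuit-edge u} e∈
    ... | true | eq = refl , eq

    circuit-in-component : ∀ {S} u → (∀ {e} → e ∈ circuit u → e ∈ S) →
      ContainsCircuit G S (component S u)
    circuit-in-component {S} u ⊆S = circuit u , circuit-isCircuit u , ⊆S , λ {e} e∈ →
      let e∈F , end₁∈ = circuit⁻ e∈
      in ∈-component⁺ (lift (from-centre end₁∈)) ,
         ∈-component⁺ (lift (from-centre (trans (sym (reach-ends F u e∈F)) end₁∈)))
      where
      lift : ∀ {x y} → Connected G (circuit u) x y → Connected G S x y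
      lift = Star.map λ (e , e∈ , joins) → e , ⊆S e∈ , joins

    -- A smaller cut would violate cyclic connectivity: the circuits of `F` through `u` and `v` each
    -- stay on one side of `X`, so they survive the removal of the cut, and they lie in different
    -- components because a walk avoiding the cut never changes side.
    confined-circuits⇒k≤cut : ∀ k → CyclicallyEdgeConnected G k → ∀ X {u v} →
      X u ≡ true → ¬ Escapes F X u → X v ≡ false → ¬ Escapes F (not ∘ X) v →
      k ≤ cut (λ _ → true) X
    confined-circuits⇒k≤cut k cyc X {u} {v} u∈X u-stays v∉X v-stays = ≮⇒≥ λ cut<k →
      cyc (C , (tabulate X , (u , ∈-tabulate⁺ u∈X) , (v , v∈∁) , refl) ,
           ≤-trans (s≤s (≤-reflexive ∣C∣≡cut)) cut<k ,
           component S u , component S v , distinct ,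
           component-isComponent S u , circuit-in-component u (circuit⊆S u-side) ,
           component-isComponent S v , circuit-in-component v (circuit⊆S v-side))
      where
      C S : EdgeSet G
      C = ∂ G (tabulate X)
      S = ∁ C

      v∈∁ : v ∈ ∁ (tabulate X)
      v∈∁ = lookup⇒[]= v _ (trans (lookup-map v not (tabulate X)) (cong not (trans (lookup∘tabulate X v) v∉X)))

      lookup-C : ∀ e → lookup C e ≡ crosses X e
      lookup-C e = trans (lookup∘tabulate (λ e → lookup (tabulate X) (end₁ e) xor lookup (tabulate X) (end₂ e)) e)
        (cong₂ _xor_ (lookup∘tabulate X (end₁ e)) (lookup∘tabulate X (end₂ e)))

      ∣C∣≡cut : ∣ C ∣ ≡ cut (λ _ → true) X
      ∣C∣≡cut = trans (∣S∣≡sum C) (sum-cong-≗ (λ e → cong ι (lookup-C e)))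

      ∈S⁺ : ∀ {e} → X (end₁ e) ≡ X (end₂ e) → e ∈ S
      ∈S⁺ {e} eq = lookup⇒[]= e S (trans (lookup-map e not C) (cong not (trans (lookup-C e)
        (trans (cong (_xor X (end₂ e)) eq) (Bool.xor-same (X (end₂ e)))))))

      ∈S⁻ : ∀ {e} → e ∈ S → X (end₁ e) ≡ X (end₂ e)
      ∈S⁻ {e} e∈S = xor-false (X (end₁ e)) _ (trans (sym (Bool.not-involutive _))
        (cong not (trans (cong not (sym (lookup-C e))) (trans (sym (lookup-map e not C)) ([]=⇒lookup e∈S)))))
        where
        xor-false : ∀ a b → a xor b ≡ false → a ≡ b
        xor-false true  true  _ = refl
        xor-false false false _ = refl

      same-side : ∀ {x y} → Connected G S x y → X x ≡ X y
      same-side ε = refl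
      same-side ((e , e∈S , inj₁ (refl , refl)) ◅ w) = trans (∈S⁻ e∈S) (same-side w)
      same-side ((e , e∈S , inj₂ (refl , refl)) ◅ w) = trans (sym (∈S⁻ e∈S)) (same-side w)

      distinct : component S u ≢ component S v
      distinct eq = true≢false u∈X (trans
        (sym (same-side (∈-component⁻ (subst (u ∈_) eq (∈-component⁺ ε))))) v∉X)

      u-side : ∀ {x} → Star (Adjacent F) u x → X x ≡ true
      u-side {x} w with X x in eq
      ... | true  = refl
      ... | false = contradiction (x , eq , w) u-stays

      v-side : ∀ {x} → Star (Adjacent F) v x → X x ≡ false
      v-side {x} w with X x in eq
      ... | false = refl
      ... | true  = contradiction (x , cong not eq , w) v-stays

      circuit⊆S : ∀ {w b} → (∀ {x} → Star (Adjacent F) w x → X x ≡ b) → ∀ {e} → e ∈ circuit w → e ∈ S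
      circuit⊆S {w} side {e} e∈ =
        let e∈F , end₁∈ = circuit⁻ e∈
        in ∈S⁺ (trans (side (does⇒ (reach? F w (end₁ e)) end₁∈))
             (sym (side (does⇒ (reach? F w (end₂ e)) (trans (sym (reach-ends F w e∈F)) end₁∈)))))

-- From a balanced valuation to a nowhere-zero 5-flow.

module Flows (G : Graph) (cubic : Cubic G) where
  open Graph G
  open Loads G
  open Matchings G
  open Cuts G
  open Components G

  all : ∀ {n} → Fin n → Bool
  all _ = true

  deg-all : ∀ v → deg all v ≡ 3
  deg-all v = trans (sym (trans (degree≡deg ⊤ v) (trans (deg-inc (lookup ⊤) v)
    (trans (sum-cong-≗ λ e → cong (λ b → inc e v * ι b) (lookup-replicate e true)) (sym (deg-inc all v))))))
    (cubic v)

  ∑-inc : ∀ v → sum (λ e → inc e v) ≡ 3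
  ∑-inc v = trans (sum-cong-≗ λ e → sym (*-identityʳ (inc e v))) (trans (sym (deg-inc all v)) (deg-all v))

  2*inside+cut : ∀ X → 2 * #inside X + cut all X ≡ 3 * # X
  2*inside+cut = regular-inside+cut all 3 deg-all

  #-colours : ∀ c X → # X ≡ # (X ∩ᵥ c) + # (X ∩ᵥ (not ∘ c))
  #-colours c X = trans (sum-cong-≗ λ v → pointwise (X v) (c v))
    (∑-distrib-+ (ι ∘ (X ∩ᵥ c)) (ι ∘ (X ∩ᵥ (not ∘ c))))
    where
    pointwise : ∀ x y → ι x ≡ ι (x ∧ y) + ι (x ∧ not y)
    pointwise true  true  = refl
    pointwise true  false = refl
    pointwise false _     = refl

  edge-count : ∀ c X → 2 * #inside X + cut all X ≡ 3 * (# (X ∩ᵥ c) + # (X ∩ᵥ (not ∘ c)))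
  edge-count c X = trans (2*inside+cut X) (cong (3 *_) (#-colours c X))

  module _ (c : Fin #V → Bool) (balanced : # c ≡ # (not ∘ c))
           (inside≤ : ∀ X → 3 * #inside X ≤ 7 * # (X ∩ᵥ c) + 2 * # (X ∩ᵥ (not ∘ c))) where

    target-load : ℕ → ℕ → Fin #V → ℕ
    target-load i j v = if c v then i else j

    ∑-target-load : ∀ i j X → sum (λ v → ι (X v) * target-load i j v) ≡ i * # (X ∩ᵥ c) + j * # (X ∩ᵥ (not ∘ c))
    ∑-target-load i j X = begin
      sum (λ v → ι (X v) * target-load i j v)
        ≡⟨ sum-cong-≗ (λ v → pointwise (X v) (c v)) ⟩
      sum (λ v → i * ι (X v ∧ c v) + j * ι (X v ∧ not (c v)))
        ≡⟨ ∑-distrib-+ (λ v → i * ι (X v ∧ c v)) (λ v → j * ι (X v ∧ not (c v))) ⟩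
      sum (λ v → i * ι (X v ∧ c v)) + sum (λ v → j * ι (X v ∧ not (c v)))
        ≡⟨ cong₂ _+_ (*-distribˡ-sum i (ι ∘ (X ∩ᵥ c))) (*-distribˡ-sum j (ι ∘ (X ∩ᵥ (not ∘ c)))) ⟨
      i * # (X ∩ᵥ c) + j * # (X ∩ᵥ (not ∘ c)) ∎
      where
      open ≡-Reasoning
      pointwise : ∀ x y → ι x * (if y then i else j) ≡ i * ι (x ∧ y) + j * ι (x ∧ not y)
      pointwise true  true  rewrite *-identityʳ i | *-zeroʳ j = refl
      pointwise true  false rewrite *-identityʳ j | *-zeroʳ i = +-identityʳ j
      pointwise false y     rewrite *-zeroʳ i | *-zeroʳ j = refl

    #E≡3*#c : #E ≡ 3 * # c
    #E≡3*#c = *-cancelˡ-≡ #E (3 * # c) 2 (begin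
      2 * #E                       ≡⟨ cong (2 *_) (trans (sum-const #E 1) (*-identityʳ #E)) ⟨
      2 * #inside all              ≡⟨ +-identityʳ _ ⟨
      2 * #inside all + 0          ≡⟨ cong (2 * #inside all +_) (cut-all all) ⟨
      2 * #inside all + cut all all ≡⟨ 2*inside+cut all ⟩
      3 * # all                    ≡⟨ cong (3 *_) (#-colours c all) ⟩
      3 * (# c + # (not ∘ c))      ≡⟨ cong (λ h → 3 * (# c + h)) balanced ⟨
      3 * (# c + # c)              ≡⟨ double (# c) ⟩
      2 * (3 * # c)                ∎)
      where
      open ≡-Reasoning
      double : ∀ h → 3 * (h + h) ≡ 2 * (3 * h)
      double = solve-∀

    -- Each colour has #E / 3 vertices, so the quotas use up d tokens per edge when i + j = 3d. The
    -- two cases needed are 2 + 1 = 3 · 1 and 7 + 2 = 3 · 3.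
    ∑-target-load-all : ∀ i j d → i + j ≡ 3 * d → sum (target-load i j) ≡ #E * d
    ∑-target-load-all i j d i+j≡3d = begin
      sum (target-load i j)                    ≡⟨ sum-cong-≗ (λ v → sym (+-identityʳ (target-load i j v))) ⟩
      sum (λ v → ι (all v) * target-load i j v) ≡⟨ ∑-target-load i j all ⟩
      i * # c + j * # (not ∘ c)                ≡⟨ cong (λ h → i * # c + j * h) balanced ⟨
      i * # c + j * # c                        ≡⟨ *-distribʳ-+ (# c) i j ⟨
      (i + j) * # c                            ≡⟨ cong (_* # c) i+j≡3d ⟩
      3 * d * # c                              ≡⟨ rearrange d (# c) ⟩
      3 * # c * d                              ≡⟨ cong (_* d) #E≡3*#c ⟨
      #E * d                                   ∎
      where
      open ≡-Reasoning
      rearrange : ∀ d h → 3 * d * h ≡ 3 * h * d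
      rearrange = solve-∀

    -- Hakimi's condition for the orientation follows from that for the values. If p ≤ m, then 7p +
    -- 2m ≤ 6p + 3m; if m ≤ p, the bare edge count 2i ≤ 3(p + m) is enough.
    inside≤orientation : ∀ X → 1 * #inside X ≤ sum (λ v → ι (X v) * target-load 2 1 v)
    inside≤orientation X = ≤-trans (bound (# (X ∩ᵥ c)) (# (X ∩ᵥ (not ∘ c))) (#inside X) (inside≤ X)
      (≤-trans (m≤m+n _ (cut all X)) (≤-reflexive (edge-count c X))))
      (≤-reflexive (sym (∑-target-load 2 1 X)))
      where
      open ≤-Reasoning
      bound : ∀ p m i → 3 * i ≤ 7 * p + 2 * m → 2 * i ≤ 3 * (p + m) → 1 * i ≤ 2 * p + 1 * m
      bound p m i 3i≤ 2i≤ with ≤-total p m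
      ... | inj₁ p≤m = *-cancelˡ-≤ 3 (begin
        3 * (1 * i)         ≡⟨ cong (3 *_) (*-identityˡ i) ⟩
        3 * i               ≤⟨ 3i≤ ⟩
        7 * p + 2 * m       ≡⟨ split p m ⟩
        6 * p + 2 * m + p   ≤⟨ +-monoʳ-≤ (6 * p + 2 * m) p≤m ⟩
        6 * p + 2 * m + m   ≡⟨ join p m ⟩
        3 * (2 * p + 1 * m) ∎)
        where
        split : ∀ p m → 7 * p + 2 * m ≡ 6 * p + 2 * m + p
        split = solve-∀
        join : ∀ p m → 6 * p + 2 * m + m ≡ 3 * (2 * p + 1 * m)
        join = solve-∀
      ... | inj₂ m≤p = *-cancelˡ-≤ 2 (begin
        2 * (1 * i)         ≡⟨ cong (2 *_) (*-identityˡ i) ⟩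
        2 * i               ≤⟨ 2i≤ ⟩
        3 * (p + m)         ≡⟨ split p m ⟩
        3 * p + 2 * m + m   ≤⟨ +-monoʳ-≤ (3 * p + 2 * m) m≤p ⟩
        3 * p + 2 * m + p   ≡⟨ join p m ⟩
        2 * (2 * p + 1 * m) ∎)
        where
        split : ∀ p m → 3 * (p + m) ≡ 3 * p + 2 * m + m
        split = solve-∀
        join : ∀ p m → 3 * p + 2 * m + p ≡ 2 * (2 * p + 1 * m)
        join = solve-∀

    -- With o the distribution of 1 token and t that of 3 tokens per edge, every edge
    -- is directed away from the end holding its o-token and gets the value 1 + (the
    -- number of its t-tokens at the other end).
    valuation⇒flow : NowhereZeroFlow G 5
    valuation⇒flow
      with Distribution.distribution G 1 (target-load 2 1) (∑-target-load-all 2 1 1 refl)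
             inside≤orientation
         | Distribution.distribution G 3 (target-load 7 2) (∑-target-load-all 7 2 3 refl)
             (λ X → ≤-trans (inside≤ X) (≤-reflexive (sym (∑-target-load 7 2 X))))
    ... | o , o-load | t , t-load = record
      { direction = direction
      ; value     = λ e → val (direction e) e
      ; value≥1   = λ e → val≥1 (direction e) e
      ; value<k   = λ e → val<5 (direction e) e
      ; kirchhoff = kirchhoff
      }
      where
      o₁ o₂ t₁ t₂ : Fin #E → ℕ
      o₁ = Distribution.Split.tokens₁ o
      o₂ = Distribution.Split.tokens₂ o
      t₁ = Distribution.Split.tokens₁ t
      t₂ = Distribution.Split.tokens₂ t

      o-total : ∀ e → o₁ e + o₂ e ≡ 1
      o-total = Distribution.Split.total o
      t-total : ∀ e → t₁ e + t₂ e ≡ 3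
      t-total = Distribution.Split.total t

      away : ℕ → Direction
      away zero    = 2→1
      away (suc _) = 1→2

      direction : Fin #E → Direction
      direction e = away (o₁ e)

      val : Direction → Fin #E → ℕ
      val 1→2 e = suc (t₂ e)
      val 2→1 e = suc (t₁ e)

      val≥1 : ∀ d e → 1 ≤ val d e
      val≥1 1→2 e = s≤s z≤n
      val≥1 2→1 e = s≤s z≤n

      val<5 : ∀ d e → val d e < 5
      val<5 1→2 e = s≤s (s≤s (≤-trans (m≤n+m (t₂ e) (t₁ e)) (≤-reflexive (t-total e))))
      val<5 2→1 e = s≤s (s≤s (≤-trans (m≤m+n (t₁ e) (t₂ e)) (≤-reflexive (t-total e))))

      in-flow out-flow : Fin #V → Fin #E → ℕ
      in-flow  v e = if does (target G (direction e) e ≟ v) then val (direction e) e else 0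
      out-flow v e = if does (source G (direction e) e ≟ v) then val (direction e) e else 0

      if-* : ∀ b n → (if b then n else 0) ≡ ι b * n
      if-* true  n = sym (+-identityʳ n)
      if-* false n = refl

      -- `A` and `B` indicate whether the vertex is the tail or the head, `s` and `t` are the value
      -- tokens at tail and head. The flow value is 1 + t; at the tail it is completed to 5 by 1 +
      -- s, since s + t = 3.
      edge-identity : ∀ A B s t → s + t ≡ 3 →
        B * suc t + 5 * A ≡ A * suc t + ((A + B) + (A * s + B * t))
      edge-identity A B s t s+t≡3 = begin
        B * suc t + 5 * A             ≡⟨ cong (λ n → B * suc t + (2 + n) * A) s+t≡3 ⟨
        B * suc t + (2 + (s + t)) * A ≡⟨ identity A B s t ⟩
        A * suc t + ((A + B) + (A * s + B * t)) ∎
        where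
        open ≡-Reasoning
        identity : ∀ A B s t → B * suc t + (2 + (s + t)) * A ≡ A * suc t + ((A + B) + (A * s + B * t))
        identity = solve-∀

      pointwise : ∀ v e →
        in-flow v e + 5 * ([ end₁ e ≐ v ] * o₁ e + [ end₂ e ≐ v ] * o₂ e) ≡
        out-flow v e + (inc e v + ([ end₁ e ≐ v ] * t₁ e + [ end₂ e ≐ v ] * t₂ e))
      pointwise v e with o₁ e | o₂ e | o-total e
      ... | suc zero | zero | refl
        rewrite if-* (does (end₂ e ≟ v)) (suc (t₂ e)) | if-* (does (end₁ e ≟ v)) (suc (t₂ e))
              | *-identityʳ [ end₁ e ≐ v ] | *-zeroʳ [ end₂ e ≐ v ] | +-identityʳ [ end₁ e ≐ v ]
        = edge-identity [ end₁ e ≐ v ] [ end₂ e ≐ v ] (t₁ e) (t₂ e) (t-total e)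
      ... | zero | suc zero | refl
        rewrite if-* (does (end₂ e ≟ v)) (suc (t₁ e)) | if-* (does (end₁ e ≟ v)) (suc (t₁ e))
              | *-identityʳ [ end₂ e ≐ v ] | *-zeroʳ [ end₁ e ≐ v ]
        = trans (edge-identity [ end₂ e ≐ v ] [ end₁ e ≐ v ] (t₂ e) (t₁ e) (trans (+-comm (t₂ e) _) (t-total e)))
            (cong ([ end₂ e ≐ v ] * suc (t₁ e) +_)
              (cong₂ _+_ (+-comm [ end₂ e ≐ v ] _) (+-comm ([ end₂ e ≐ v ] * t₂ e) _)))

      kirchhoff : ∀ v → sum (in-flow v) ≡ sum (out-flow v)
      kirchhoff v = +-cancelʳ-≡ (5 * target-load 2 1 v) _ _ (begin
        sum (in-flow v) + 5 * target-load 2 1 v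
          ≡⟨ cong (λ l → sum (in-flow v) + 5 * l) (o-load v) ⟨
        sum (in-flow v) + 5 * load o₁ o₂ v
          ≡⟨ cong (sum (in-flow v) +_) (*-distribˡ-sum 5 (λ e → [ end₁ e ≐ v ] * o₁ e + [ end₂ e ≐ v ] * o₂ e)) ⟩
        sum (in-flow v) + sum (λ e → 5 * ([ end₁ e ≐ v ] * o₁ e + [ end₂ e ≐ v ] * o₂ e))
          ≡⟨ ∑-distrib-+ (in-flow v) (λ e → 5 * ([ end₁ e ≐ v ] * o₁ e + [ end₂ e ≐ v ] * o₂ e)) ⟨
        sum (λ e → in-flow v e + 5 * ([ end₁ e ≐ v ] * o₁ e + [ end₂ e ≐ v ] * o₂ e))
          ≡⟨ sum-cong-≗ (pointwise v) ⟩
        sum (λ e → out-flow v e + (inc e v + ([ end₁ e ≐ v ] * t₁ e + [ end₂ e ≐ v ] * t₂ e)))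
          ≡⟨ ∑-distrib-+ (out-flow v) (λ e → inc e v + ([ end₁ e ≐ v ] * t₁ e + [ end₂ e ≐ v ] * t₂ e)) ⟩
        sum (out-flow v) + sum (λ e → inc e v + ([ end₁ e ≐ v ] * t₁ e + [ end₂ e ≐ v ] * t₂ e))
          ≡⟨ cong (sum (out-flow v) +_)
               (∑-distrib-+ (λ e → inc e v) (λ e → [ end₁ e ≐ v ] * t₁ e + [ end₂ e ≐ v ] * t₂ e)) ⟩
        sum (out-flow v) + (sum (λ e → inc e v) + load t₁ t₂ v)
          ≡⟨ cong (sum (out-flow v) +_) (cong₂ _+_ (∑-inc v) (t-load v)) ⟩
        sum (out-flow v) + (3 + target-load 7 2 v)
          ≡⟨ cong (sum (out-flow v) +_) (loads-agree (c v)) ⟩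
        sum (out-flow v) + 5 * target-load 2 1 v ∎)
        where
        open ≡-Reasoning
        -- Origin of the quotas: summing the edge identities at a vertex of out-degree r leaves
        -- Kirchhoff's law exactly when it holds 5r - 3 value tokens, which is 7 for r = 2 and 2 for
        -- r = 1.
        loads-agree : ∀ b → 3 + (if b then 7 else 2) ≡ 5 * (if b then 2 else 1)
        loads-agree true  = refl
        loads-agree false = refl

-- A 1-factor as an involution.

module OneFactors (G : Graph) where
  open Graph G
  open Loads G
  open Matchings G

  -- Puts a 1-factor into the form in which `two-colouring` takes the first of its two matchings.
  mates : ∀ M → (∀ v → deg M v ≡ 1) →
    Σ[ σ ∈ (Fin #V → Fin #V) ] (∀ v → σ (σ v) ≡ v) × (∀ v → σ v ≢ v) ×
      (∀ {e} → M e ≡ true → end₂ e ≡ σ (end₁ e))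
  mates M perfect = σ , σσ , (λ v → v≢σv v ∘ sym) , end₂≡σ
    where
    matching : IsMatching M
    matching v = ≤-reflexive (perfect v)

    mate : ∀ v → ∃[ w ] ∃[ e ] M e ≡ true × Joins G e v w
    mate v with incident-edge M {v} (subst (0 <_) (sym (perfect v)) (s≤s z≤n))
    ... | e , e∈M , inj₁ eq = end₂ e , e , e∈M , inj₁ (eq , refl)
    ... | e , e∈M , inj₂ eq = end₁ e , e , e∈M , inj₂ (refl , eq)

    σ : Fin #V → Fin #V
    σ v = proj₁ (mate v)

    v≢σv : ∀ v → v ≢ σ v
    v≢σv v v≡σv =
      let w , e , e∈M , joins = mate v
      in matching-loopless {M} matching e∈M (joins-loop (subst (Joins G e v) (sym v≡σv) joins))

    determined : ∀ {e f v w} → M e ≡ true → M f ≡ true → Joins G e v w → Incident f v → e ≡ f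
    determined e∈M f∈M joins f∋v = unique-incident {M} matching e∈M f∈M (joins⇒incidentˡ joins) f∋v

    σσ : ∀ v → σ (σ v) ≡ v
    σσ v with mate v | v≢σv v
    ... | w , e , e∈M , joins | v≢w with mate w
    ...   | w′ , e′ , e′∈M , joins′ with determined e′∈M e∈M joins′ (joins⇒incidentʳ joins)
    ...     | refl = joins-other joins joins′ v≢w

    end₂≡σ : ∀ {e} → M e ≡ true → end₂ e ≡ σ (end₁ e)
    end₂≡σ {e} e∈M with mate (end₁ e)
    ... | w , e′ , e′∈M , joins with determined e′∈M e∈M joins (inj₁ refl) | joins
    ...   | refl | inj₁ (_ , q) = q
    ...   | refl | inj₂ (p , q) = trans q p

-- The valuation inequality for two 1-factors with `n` common edges.

module FromOneFactors (G : Graph) (cubic : Cubic G) (k n : ℕ) (cyclic : CyclicallyEdgeConnected G k)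
  (M₁ M₂ : Fin (Graph.#E G) → Bool)
  (perfect₁ : ∀ v → Matchings.deg G M₁ v ≡ 1) (perfect₂ : ∀ v → Matchings.deg G M₂ v ≡ 1)
  (n≡ : n ≡ sum (λ e → ι (M₁ e ∧ M₂ e))) (k≥ : k ≥ 5 * n ∸ 3) where

  open Graph G
  open Loads G
  open Matchings G
  open Cuts G
  open Components G
  open Flows G cubic
  open OneFactors G

  F : Fin #E → Bool
  F = not ∘ M₁

  M₁+F : ∀ e → ι (M₁ e) + ι (F e) ≡ ι (all e)
  M₁+F e with M₁ e
  ... | true  = refl
  ... | false = refl

  F-2-regular : ∀ v → deg F v ≡ 2
  F-2-regular v = +-cancelˡ-≡ 1 _ _
    (trans (cong (_+ deg F v) (sym (perfect₁ v))) (trans (deg-+ M₁+F v) (deg-all v)))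

  M₂∖M₁ M₁∩M₂ : Fin #E → Bool
  M₂∖M₁ e = M₂ e ∧ not (M₁ e)
  M₁∩M₂ e = M₁ e ∧ M₂ e

  M₂-split : ∀ e → ι (M₂∖M₁ e) + ι (M₁∩M₂ e) ≡ ι (M₂ e)
  M₂-split e with M₁ e | M₂ e
  ... | true  | true  = refl
  ... | true  | false = refl
  ... | false | true  = refl
  ... | false | false = refl

  M₂∖M₁-matching : IsMatching M₂∖M₁
  M₂∖M₁-matching v = ≤-trans (m≤m+n _ _) (≤-reflexive (trans (deg-+ M₂-split v) (perfect₂ v)))

  M₂∖M₁⊆F : M₂∖M₁ ⊆ₑ F
  M₂∖M₁⊆F {e} e∈ with M₂ e
  ... | true = e∈

  five-flow : NowhereZeroFlow G 5
  five-flow with separating-matching F (≤-reflexive ∘ F-2-regular) M₂∖M₁ M₂∖M₁⊆F M₂∖M₁-matching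
            | mates M₁ perfect₁
  ... | M , M⊆F , matching , size≥ , separated | σ , σσ , σ≢ , end₂≡σ
    with two-colouring #E M end₁ end₂ (matching-loopless {M} matching)
           (unique-incident {M} matching) σ σσ σ≢
  ...   | c , c-σ , c-M = valuation⇒flow c balanced inside≤
    where
    open Coloured c

    c-M₁ : Bichromatic M₁
    c-M₁ e∈M₁ = trans (cong c (end₂≡σ e∈M₁)) (c-σ _)

    -- `none` is for the perfect `M₁` what `Z` is for `M`, so that `colour-excess` serves both
    -- matchings.
    Z none : Fin #V → Bool
    Z v    = does (deg M v ℕ.≟ 0)
    none _ = false

    M+Z : ∀ v → deg M v + ι (Z v) ≡ 1
    M+Z v with deg M v | matching v
    ... | zero        | _ = refl
    ... | suc zero    | _ = refl
    ... | suc (suc _) | s≤s ()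

    M₁+none : ∀ v → deg M₁ v + ι (none v) ≡ 1
    M₁+none v = trans (+-identityʳ _) (perfect₁ v)

    Z-separated : ∀ {u v} → Z u ≡ true → Z v ≡ true → Star (Adjacent F) u v → u ≡ v
    Z-separated {u} {v} u∈Z v∈Z =
      separated (does⇒ (deg M u ℕ.≟ 0) u∈Z) (does⇒ (deg M v ℕ.≟ 0) v∈Z)

    M₁-excess : ∀ k X → # (X ∩ᵥ colour (not k)) ≤ # (X ∩ᵥ colour k) + cut M₁ X
    M₁-excess k X = begin
      # (X ∩ᵥ colour (not k))
        ≤⟨ m≤m+n _ _ ⟩
      # (X ∩ᵥ colour (not k)) + # ((X ∩ᵥ none) ∩ᵥ colour k)
        ≤⟨ colour-excess c-M₁ M₁+none k X ⟩
      # (X ∩ᵥ colour k) + cut M₁ X + # ((X ∩ᵥ none) ∩ᵥ colour (not k))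
        ≡⟨ cong (# (X ∩ᵥ colour k) + cut M₁ X +_) empty ⟩
      # (X ∩ᵥ colour k) + cut M₁ X + 0
        ≡⟨ +-identityʳ _ ⟩
      # (X ∩ᵥ colour k) + cut M₁ X ∎
      where
      open ≤-Reasoning
      empty : # ((X ∩ᵥ none) ∩ᵥ colour (not k)) ≡ 0
      empty = trans (sum-cong-≗ λ v → cong (λ b → ι (b ∧ colour (not k) v)) (Bool.∧-zeroʳ (X v)))
        (sum-replicate-zero #V)

    M-excess : ∀ k X → # (X ∩ᵥ colour (not k)) ≤
      # (X ∩ᵥ colour k) + cut M X + # ((X ∩ᵥ Z) ∩ᵥ colour (not k))
    M-excess k X = ≤-trans (m≤m+n _ _) (colour-excess c-M M+Z k X)

    #-monochromatic : ∀ k → # (colour (not k)) ≤ # (colour k)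
    #-monochromatic k = ≤-trans (M₁-excess k all) (≤-reflexive
      (trans (cong (# (colour k) +_) (cut-all M₁)) (+-identityʳ _)))

    balanced : # (colour true) ≡ # (colour false)
    balanced = ≤-antisym (#-monochromatic false) (#-monochromatic true)

    -- The whole vertex set has an empty cut, and `M` covers equally many vertices of each colour;
    -- as the colour classes are equal, so are the uncovered parts.
    Z-balanced : # (Z ∩ᵥ colour false) ≤ # (Z ∩ᵥ colour true)
    Z-balanced = +-cancelˡ-≤ (# (colour true)) _ _ (begin
      # (colour true) + # (Z ∩ᵥ colour false)
        ≤⟨ colour-excess c-M M+Z false all ⟩
      # (colour false) + cut M all + # (Z ∩ᵥ colour true)
        ≡⟨ cong₂ (λ x y → x + y + # (Z ∩ᵥ colour true)) (sym balanced) (cut-all M) ⟩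
      # (colour true) + 0 + # (Z ∩ᵥ colour true)
        ≡⟨ cong (_+ # (Z ∩ᵥ colour true)) (+-identityʳ _) ⟩
      # (colour true) + # (Z ∩ᵥ colour true) ∎)
      where open ≤-Reasoning

    ∑deg : ∀ S → sum (deg S) ≡ 2 * size S
    ∑deg S = begin
      sum (deg S)             ≡⟨ sum-cong-≗ (λ v → sym (*-identityˡ (deg S v))) ⟩
      sum (λ v → 1 * deg S v) ≡⟨ ∑-*-deg (λ _ → 1) S ⟩
      sum (λ e → 2 * ι (S e)) ≡⟨ *-distribˡ-sum 2 (ι ∘ S) ⟨
      2 * size S              ∎
      where open ≡-Reasoning

    -- `M₂` is perfect, so its part outside `M₁` misses only the 2n ends of the common edges, and
    -- `M` is at least as large as that part.
    #Z≤2n : # Z ≤ 2 * n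
    #Z≤2n = +-cancelˡ-≤ (2 * size M₂∖M₁) _ _ (begin
      2 * size M₂∖M₁ + # Z              ≤⟨ +-monoˡ-≤ (# Z) (*-monoʳ-≤ 2 size≥) ⟩
      2 * size M + # Z                  ≡⟨ cong (_+ # Z) (∑deg M) ⟨
      sum (deg M) + # Z                 ≡⟨ ∑-distrib-+ (deg M) (ι ∘ Z) ⟨
      sum (λ v → deg M v + ι (Z v))     ≡⟨ sum-cong-≗ (λ v → trans (M+Z v) (sym (perfect₂ v))) ⟩
      sum (deg M₂)                      ≡⟨ ∑deg M₂ ⟩
      2 * size M₂                       ≡⟨ cong (2 *_) (sum-cong-≗ M₂-split) ⟨
      2 * sum (λ e → ι (M₂∖M₁ e) + ι (M₁∩M₂ e)) ≡⟨ cong (2 *_) (∑-distrib-+ (ι ∘ M₂∖M₁) (ι ∘ M₁∩M₂)) ⟩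
      2 * (size M₂∖M₁ + size M₁∩M₂)     ≡⟨ cong (λ i → 2 * (size M₂∖M₁ + i)) n≡ ⟨
      2 * (size M₂∖M₁ + n)              ≡⟨ *-distribˡ-+ 2 (size M₂∖M₁) n ⟩
      2 * size M₂∖M₁ + 2 * n            ∎)
      where open ≤-Reasoning

    #Z-false≤n : # (Z ∩ᵥ colour false) ≤ n
    #Z-false≤n = *-cancelˡ-≤ 2 (begin
      2 * # (Z ∩ᵥ colour false)                       ≡⟨ cong (# (Z ∩ᵥ colour false) +_) (+-identityʳ _) ⟩
      # (Z ∩ᵥ colour false) + # (Z ∩ᵥ colour false)   ≤⟨ +-monoˡ-≤ _ Z-balanced ⟩
      # (Z ∩ᵥ colour true) + # (Z ∩ᵥ colour false)    ≡⟨ #-colours c Z ⟨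
      # Z                                             ≤⟨ #Z≤2n ⟩
      2 * n                                           ∎)
      where open ≤-Reasoning

    cut-split : ∀ X → cut M₁ X + cut F X ≡ cut all X
    cut-split = cut-+ M₁+F

    Confined : (Fin #V → Bool) → Set
    Confined X = ∃[ u ] (X u ≡ true × Z u ≡ true) × ¬ Escapes F X u

    escapes? : ∀ X u → Dec (Escapes F X u)
    escapes? X u = any? λ v → (X v Bool.≟ false) ×-dec reach? F u v

    confined? : ∀ X → Dec (Confined X)
    confined? X = any? λ u → ((X u Bool.≟ true) ×-dec (Z u Bool.≟ true)) ×-dec ¬? (escapes? X u)

    -- The number `z` of uncovered vertices of one colour in `X` is bounded crudely by all uncovered
    -- vertices in `X`, each of which has a circuit of its own leaving `X`.
    unconfined-bound : ∀ k X → ¬ Confined X →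
      5 * # (X ∩ᵥ colour (not k)) ≤ 5 * # (X ∩ᵥ colour k) + 3 * cut all X
    unconfined-bound k X unconfined = ≤-trans
      (cut-bound _ _ (cut M₁ X) (cut M X) (cut F X) _ (M₁-excess k X) (M-excess k X) (cut-⊆ M⊆F X)
        (≤-trans (*-monoʳ-≤ 2 (#-⊆ {(X ∩ᵥ Z) ∩ᵥ colour (not k)} {X ∩ᵥ Z} λ {v} → ∧-left (X v ∧ Z v)))
          (escaping-cut F F-2-regular Z-separated X λ u u∈X u∈Z →
            decidable-stable (escapes? X u) λ stays → unconfined (u , (u∈X , u∈Z) , stays))))
      (≤-reflexive (cong (λ d → 5 * # (X ∩ᵥ colour k) + 3 * d) (cut-split X)))
      where
      ∧-left : ∀ a {b} → a ∧ b ≡ true → a ≡ true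
      ∧-left true _ = refl

    colour-split : ∀ k X → # (colour k) ≡ # (X ∩ᵥ colour k) + # ((not ∘ X) ∩ᵥ colour k)
    colour-split k X = trans (sum-cong-≗ λ v → pointwise (X v) (colour k v))
      (∑-distrib-+ (ι ∘ (X ∩ᵥ colour k)) (ι ∘ ((not ∘ X) ∩ᵥ colour k)))
      where
      pointwise : ∀ x y → ι y ≡ ι (x ∧ y) + ι (not x ∧ y)
      pointwise true  y = sym (+-identityʳ (ι y))
      pointwise false y = refl

    -- The colour classes are equal, so the excess of one colour in `X` is the excess of the other
    -- in the complement, which has the same cut. Hence `unconfined-bound` is applied there with the
    -- colours exchanged.
    complement-bound : ∀ X → ¬ Confined (not ∘ X) →
      5 * # (X ∩ᵥ colour false) ≤ 5 * # (X ∩ᵥ colour true) + 3 * cut all X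
    complement-bound X unconfined = complement
      (# (X ∩ᵥ colour true)) (# (X ∩ᵥ colour false))
      (# ((not ∘ X) ∩ᵥ colour true)) (# ((not ∘ X) ∩ᵥ colour false)) (cut all X)
      (trans (sym (colour-split true X)) (trans balanced (colour-split false X)))
      (≤-trans (unconfined-bound false (not ∘ X) unconfined)
        (≤-reflexive (cong (λ d → 5 * # ((not ∘ X) ∩ᵥ colour false) + 3 * d) (cut-complement all X))))
      where
      complement : ∀ p m p′ m′ d → p + p′ ≡ m + m′ → 5 * p′ ≤ 5 * m′ + 3 * d → 5 * m ≤ 5 * p + 3 * d
      complement p m p′ m′ d eq 5p′≤ = +-cancelʳ-≤ (5 * m′) _ _ (begin
        5 * m + 5 * m′           ≡⟨ *-distribˡ-+ 5 m m′ ⟨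
        5 * (m + m′)             ≡⟨ cong (5 *_) eq ⟨
        5 * (p + p′)             ≡⟨ *-distribˡ-+ 5 p p′ ⟩
        5 * p + 5 * p′           ≤⟨ +-monoʳ-≤ (5 * p) 5p′≤ ⟩
        5 * p + (5 * m′ + 3 * d) ≡⟨ swap p m′ d ⟩
        5 * p + 3 * d + 5 * m′   ∎)
        where
        open ≤-Reasoning
        swap : ∀ p m d → 5 * p + (5 * m + 3 * d) ≡ 5 * p + 3 * d + 5 * m
        swap = solve-∀

    inside≤ : ∀ X → 3 * #inside X ≤ 7 * # (X ∩ᵥ c) + 2 * # (X ∩ᵥ (not ∘ c))
    inside≤ X with confined? X | confined? (not ∘ X)
    ... | no unconfined | _ = valuation⇒inside _ (# (X ∩ᵥ c)) (cut all X) (#inside X)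
      (unconfined-bound true X unconfined) (edge-count c X)
    ... | yes _ | no unconfined = valuation⇒inside _ (# (X ∩ᵥ c)) (cut all X) (#inside X)
      (complement-bound X unconfined) (edge-count c X)
    -- Each side now contains a whole circuit, so cyclic connectivity makes the cut large, and the
    -- global bound `n` on uncovered vertices of one colour is enough.
    ... | yes (u , (u∈X , _) , u-stays) | yes (v , (v∉X , _) , v-stays) =
      large-cut-bound _ (# (X ∩ᵥ c)) (cut M₁ X) (cut M X) (cut F X) n (#inside X)
        (M₁-excess true X)
        (≤-trans (M-excess true X) (+-monoʳ-≤ (# (X ∩ᵥ c) + cut M X) Z≤n))
        (cut-⊆ M⊆F X)
        5n≤
        (trans (cong (2 * #inside X +_) (cut-split X)) (edge-count c X))
      where
      open ≤-Reasoning
      Z≤n : # ((X ∩ᵥ Z) ∩ᵥ colour false) ≤ n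
      Z≤n = ≤-trans (#-⊆ {(X ∩ᵥ Z) ∩ᵥ colour false} {Z ∩ᵥ colour false} λ {v} → drop (X v)) #Z-false≤n
        where
        drop : ∀ a {b d} → (a ∧ b) ∧ d ≡ true → b ∧ d ≡ true
        drop true eq = eq

      v∉X′ : X v ≡ false
      v∉X′ = trans (sym (Bool.not-involutive (X v))) (cong not v∉X)

      k≤cut : k ≤ cut all X
      k≤cut = confined-circuits⇒k≤cut F F-2-regular k cyclic X u∈X u-stays v∉X′ v-stays

      5n≤ : 5 * n ≤ 3 + (cut M₁ X + cut F X)
      5n≤ = begin
        -- This inequality allows for truncation, so n = 0, where 5n ∸ 3 is 0, is not a separate
        -- case.
        5 * n                       ≤⟨ m≤n+m∸n (5 * n) 3 ⟩
        3 + (5 * n ∸ 3)             ≤⟨ +-monoʳ-≤ 3 k≥ ⟩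
        3 + k                       ≤⟨ +-monoʳ-≤ 3 k≤cut ⟩
        3 + cut all X               ≡⟨ cong (3 +_) (cut-split X) ⟨
        3 + (cut M₁ X + cut F X)    ∎

theorem1p3 : (k : ℕ) → k > 0 →
    (G : Graph) → Cubic G → Bridgeless G → CyclicallyEdgeConnected G k →
    (μ₂ : ℕ) → Isμ₂ G μ₂ →
    k ≥ 5 * μ₂ ∸ 3 →
    NowhereZeroFlow G 5
theorem1p3 k _ G cubic _ cyclic μ₂ ((M₁ , M₂ , factor₁ , factor₂ , μ₂≡) , _) k≥ =
  FromOneFactors.five-flow G cubic k μ₂ cyclic (lookup M₁) (lookup M₂)
    (λ v → trans (sym (Matchings.degree≡deg G M₁ v)) (factor₁ v))
    (λ v → trans (sym (Matchings.degree≡deg G M₂ v)) (factor₂ v))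
    (trans μ₂≡ (trans (∣S∣≡sum (M₁ ∩ M₂)) (sum-cong-≗ λ e → cong ι (lookup-zipWith _∧_ e M₁ M₂))))
    k≥
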